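{- Let $\boldsymbol{\Upsilon}_{\mathbf{GP}}:\mathbf{GP}\to\mathbf{WQSym}$ be the linear map sending a generalized permutahedron $\mathfrak{q}\subseteq\mathbb{R}^n$ to $\boldsymbol{\Upsilon}_{\mathbf{GP}}(\mathfrak{q})=\sum_f\mathbf{a}_{f(1)}\cdots\mathbf{a}_{f(n)}$, the sum running over all $\mathfrak{q}$-generic functions $f:[n]\to\mathbb{N}$. Then the image of $\boldsymbol{\Upsilon}_{\mathbf{GP}}$ is precisely $\mathbf{SC}$.
   Context: $\mathbb{K}$ is a field of characteristic zero; $\mathbb{N}=\{1,2,\dots\}$, $[n]=\{1,\dots,n\}$; $\{\mathbf{a}_i\}_{i\ge1}$ are non-commuting variables. For non-empty $J\subseteq[n]$ let $\mathfrak{s}_J=\mathrm{conv}\{e_j : j\in J\}\subseteq\mathbb{R}^n$. A generalized permutahedron in $\mathbb{R}^n$ is a polytope $\mathfrak{q}$ of the form $\mathfrak{q}=\big(\sum_{a_J>0}a_J\mathfrak{s}_J\big)-\big(\sum_{a_J<0}|a_J|\mathfrak{s}_J\big)$ for real numbers $\{a_J\}_{\emptyset\ne J\subseteq[n]}$ for which the Minkowski difference exists; here $\mathfrak{a}-\mathfrak{b}$ denotes the unique polytope $\mathfrak{c}$ with $\mathfrak{b}+\mathfrak{c}=\mathfrak{a}$ (Minkowski sum), if it exists, and an empty Minkowski sum is $\{0\}$. $\mathbf{GP}=\bigoplus_{n\ge0}\mathbf{GP}_n$, with $\mathbf{GP}_n$ the $\mathbb{K}$-vector space freely generated by generalized permutahedra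 in $\mathbb{R}^n$. A function $f:[n]\to\mathbb{N}$ is $\mathfrak{q}$-generic if the face of $\mathfrak{q}$ on which $x\mapsto\sum_i f(i)x_i$ is minimized is a point. $\mathbf{C}_n$ is the set of set compositions $\vec{\boldsymbol{\pi}}=S_1|\cdots|S_k$ of $[n]$ (ordered lists of non-empty disjoint sets with union $[n]$). For non-empty $A\subseteq[n]$, $A_{\vec{\boldsymbol{\pi}}}=A\cap S_i$ with $i$ the smallest index such that $A\cap S_i\neq\emptyset$. For $f:[n]\to\mathbb{N}$, $\vec{\boldsymbol{\pi}}(f)$ is obtained from $f^{ -1}(1)|f^{ -1}(2)|\cdots$ by deleting empty sets. $\mathbf{M}_{\vec{\boldsymbol{\pi}}}=\sum_{f:\,\vec{\boldsymbol{\pi}}(f)=\vec{\boldsymbol{\pi}}}\mathbf{a}_{f(1)}\cdots\mathbf{a}_{f(n)}$; $\mathbf{WQSym}$ is the $\mathbb{K}$-span of all $\mathbf{M}_{\vec{\boldsymbol{\pi}}}$, $\vec{\boldsymbol{\pi}}\in\mathbf{C}_n$, $n\ge0$. On $\mathbf{C}_n$ set $\vec{\boldsymbol{\pi}}\sim\vec{\boldsymbol{\tau}}$ if for every non-empty $A\subseteq[n]$: $\#A_{\vec{\boldsymbol{\pi}}}=1\Leftrightarrow\#A_{\vec{\boldsymbol{\tau}}}=1$. Let $\mathbf{N}_{[\vec{\boldsymbol{\pi}}]}=\sum_{\vec{\boldsymbol{\tau}}\sim\vec{\boldsymbol{\pi}}}\mathbf{M}_{\vec{\boldsymbol{\tau}}}$.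 $\mathbf{SC}$ is the $\mathbb{K}$-span of all $\mathbf{N}_{[\vec{\boldsymbol{\pi}}]}$, $[\vec{\boldsymbol{\pi}}]\in\mathbf{C}_n/\!\sim$, $n\ge0$. -}

module Defs where

open import Algebra.Apartness.Bundles using (HeytingField; HeytingCommutativeRing)
open import Algebra.Bundles using (CommutativeRing)
import Algebra.Properties.Ring as RingProperties
import Algebra.Properties.Semiring.Mult as Multiples
import Algebra.Properties.Semiring.Sum as Summation
open import Data.Bool.Base using (Bool; true; false; if_then_else_)
import Data.Bool.Properties as Bool
open import Data.Empty using (⊥-elim)
open import Data.Fin.Base using (Fin; zero; suc)
import Data.Fin.Properties as Fin
open import Data.Fin.Subset using (Subset; inside; outside; Nonempty; Empty; _∩_; ⋃; ∣_∣; ⊥; ⊤)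
open import Data.Fin.Subset.Properties using (nonempty?; anySubset?; _∈?_)
open import Data.List.Base using (List; []; _∷_; _++_; map; filter; foldr; concatMap; length; lookup; allFin; upTo)
import Data.List.Extrema.Nat as Extrema
import Data.List.Properties as List
open import Data.List.Relation.Unary.All using (All; all?)
open import Data.List.Relation.Unary.AllPairs using (AllPairs; allPairs?)
open import Data.Nat.Base as ℕ using (ℕ; zero; suc)
import Data.Nat.Properties as ℕ
open import Data.Product.Base using (Σ; ∃; _×_; _,_; proj₁; proj₂)
open import Data.Sum.Base using (inj₁; inj₂)
open import Data.Vec.Base as Vec using (Vec; []; _∷_; toList)
open import Data.Vec.Functional using (Vector)
import Data.Vec.Properties as Vec
open import Function.Base using (_∘_)
open import Function.Bundles using (_⇔_; mk⇔; Equivalence)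
open import Level using (Level; 0ℓ; _⊔_)
open import Relation.Binary.Core using (Rel)
import Relation.Binary.Construct.NonStrictToStrict as NonStrictToStrict
open import Relation.Binary.Definitions using (DecidableEquality)
open import Relation.Binary.PropositionalEquality as ≡ using (_≡_)
import Relation.Binary.Reasoning.Setoid as SetoidReasoning
open import Relation.Binary.Structures using (IsDecTotalOrder)
open import Relation.Nullary.Decidable using (Dec; yes; no; does; map′; ¬?; decidable-stable; _×-dec_; _→-dec_)
open import Relation.Nullary.Negation using (¬_; contradiction)
open import Relation.Unary using (Pred; Decidable; _∈_; _≐_)

CharacteristicZero : ∀ {c ℓ₁ ℓ₂} → HeytingField c ℓ₁ ℓ₂ → Set ℓ₁
CharacteristicZero K = ∀ n → n ×ℕ 1# ≈ 0# → n ≡ 0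
  where
  open HeytingField K
  open CommutativeRing (HeytingCommutativeRing.commutativeRing heytingCommutativeRing)
    using (semiring)
  open Multiples semiring renaming (_×_ to _×ℕ_)

-- The real numbers, given axiomatically as a Dedekind-complete totally
-- ordered field.  Following classical usage the order is decidable and
-- the apartness of the underlying field is the negation of equality.

record Reals : Set₁ where
  infix 4 _≤_
  field
    heytingField : HeytingField 0ℓ 0ℓ 0ℓ

  open HeytingField heytingField public

  field
    ≉⇒#             : ∀ {x y} → ¬ (x ≈ y) → x # y
    _≤_             : Rel Carrier 0ℓ
    isDecTotalOrder : IsDecTotalOrder _≈_ _≤_
    +-monoˡ-≤       : ∀ {x y} z → x ≤ y → x + z ≤ y + z
    *-nonNegative   : ∀ {x y} → 0# ≤ x → 0# ≤ y → 0# ≤ x * y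
    supremum        : (P : Pred Carrier 0ℓ) → ∃ P → (∃ λ b → ∀ x → P x → x ≤ b) →
                      ∃ λ s → (∀ x → P x → x ≤ s) ×
                              (∀ b → (∀ x → P x → x ≤ b) → s ≤ b)

  commutativeRing : CommutativeRing 0ℓ 0ℓ
  commutativeRing = HeytingCommutativeRing.commutativeRing heytingCommutativeRing

  open CommutativeRing commutativeRing public using (semiring; ring)
  open Summation semiring public
    using (sum; sum-cong-≋; ∑-comm; ∑-distrib-+; *-distribˡ-sum; *-distribʳ-sum; sum-replicate-zero)
  open Multiples semiring public using (×-assoc-*; ×-congʳ) renaming (_×_ to _×ℕ_)
  open IsDecTotalOrder isDecTotalOrder public
    using (_≟_; _≤?_; total; antisym)
    renaming (refl to ≤-refl; reflexive to ≤-reflexive; trans to ≤-trans)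
  open NonStrictToStrict _≈_ _≤_ public using (_<_)

  _<?_ : (x y : Carrier) → Dec (x < y)
  _<?_ = NonStrictToStrict.<-decidable _≈_ _≤_ _≟_ _≤?_

allSubsets : ∀ n → List (Subset n)
allSubsets zero    = [] ∷ []
allSubsets (suc n) = map (inside ∷_) (allSubsets n) ++ map (outside ∷_) (allSubsets n)

record IsSetComposition {n : ℕ} (blocks : List (Subset n)) : Set where
  constructor isSetComposition
  field
    nonempty : All Nonempty blocks
    disjoint : AllPairs (λ S T → Empty (S ∩ T)) blocks
    covering : ⋃ blocks ≡ ⊤

SetComposition : ℕ → Set
SetComposition n = Σ (List (Subset n)) IsSetComposition

_≟ˢ_ : ∀ {n} → DecidableEquality (Subset n)
_≟ˢ_ = Vec.≡-dec Bool._≟_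

_≟ᵇ_ : ∀ {n} → DecidableEquality (List (Subset n))
_≟ᵇ_ = List.≡-dec _≟ˢ_

isSetComposition? : ∀ {n} → Decidable (IsSetComposition {n})
isSetComposition? π =
  map′ (λ (a , b , c) → isSetComposition a b c)
       (λ (isSetComposition a b c) → a , b , c)
       (all? nonempty? π
         ×-dec allPairs? (λ S T → ¬? (nonempty? (S ∩ T))) π
         ×-dec (⋃ π ≟ˢ ⊤))

listsUpTo : ∀ {A : Set} → ℕ → List A → List (List A)
listsUpTo zero    xs = [] ∷ []
listsUpTo (suc k) xs = [] ∷ concatMap (λ x → map (x ∷_) (listsUpTo k xs)) xs

-- Every set composition of [n], once each: having non-empty disjoint
-- blocks, it has at most n of them.

setCompositions : ∀ n → List (List (Subset n))
setCompositions n = filter isSetComposition? (listsUpTo n (allSubsets n))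

-- A ↾ π is A_π.  If A meets no block (in particular if A is empty) the
-- value is junk.

_↾_ : ∀ {n} → Subset n → List (Subset n) → Subset n
A ↾ []      = ⊥
A ↾ (S ∷ π) = if does (nonempty? (A ∩ S)) then A ∩ S else A ↾ π

_∼_ : ∀ {n} → List (Subset n) → List (Subset n) → Set
π ∼ τ = ∀ A → Nonempty A → ∣ A ↾ π ∣ ≡ 1 ⇔ ∣ A ↾ τ ∣ ≡ 1

_∼?_ : ∀ {n} (π τ : List (Subset n)) → Dec (π ∼ τ)
π ∼? τ =
  map′ (λ ¬bad A → decidable-stable (agrees? A) (λ bad → ¬bad (A , bad)))
       (λ π∼τ (A , bad) → bad (π∼τ A))
       (¬? (anySubset? (¬? ∘ agrees?)))
  where
  agrees? : ∀ A → Dec (Nonempty A → ∣ A ↾ π ∣ ≡ 1 ⇔ ∣ A ↾ τ ∣ ≡ 1)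
  agrees? A = nonempty? A →-dec
    map′ (λ (to , from) → mk⇔ to from)
         (λ e → Equivalence.to e , Equivalence.from e)
         (((∣ A ↾ π ∣ ℕ.≟ 1) →-dec (∣ A ↾ τ ∣ ℕ.≟ 1))
           ×-dec ((∣ A ↾ τ ∣ ℕ.≟ 1) →-dec (∣ A ↾ π ∣ ℕ.≟ 1)))

-- The variables are a₁, a₂, …; the letter k : ℕ stands for the variable
-- of index suc k.  A word w : Vec ℕ n is thus at once a monomial of
-- degree n and the function f : [n] → {1, 2, …}, f(i) = suc (lookup w i).

preimage : ∀ {n} → Vec ℕ n → ℕ → Subset n
preimage w k = Vec.map (λ x → does (x ℕ.≟ k)) w

compositionOf : ∀ {n} → Vec ℕ n → List (Subset n)
compositionOf w =
  filter nonempty? (map (preimage w) (upTo (suc (Extrema.max 0 (toList w)))))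

module _ {c ℓ₁ ℓ₂ : Level} (K : HeytingField c ℓ₁ ℓ₂) where

  open HeytingField K

  -- F n w is the coefficient of the degree n monomial w.
  Series : Set c
  Series = ∀ n → Vec ℕ n → Carrier

  _≈ˢ_ : Series → Series → Set ℓ₁
  F ≈ˢ G = ∀ n w → F n w ≈ G n w

  linearCombination : ∀ {i} {I : Set i} → (I → Series) → List (Carrier × I) → Series
  linearCombination g []             n w = 0#
  linearCombination g ((a , x) ∷ as) n w = a * g x n w + linearCombination g as n w

  Span : ∀ {i} {I : Set i} → (I → Series) → Pred Series (c ⊔ ℓ₁ ⊔ i)
  Span g F = ∃ λ as → F ≈ˢ linearCombination g as

  -- The sum of all monomials of degree m satisfying P.
  monomialSum : ∀ {p m} {P : Pred (Vec ℕ m) p} → Decidable P → Series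
  monomialSum {m = m} P? n w with m ℕ.≟ n
  ... | yes ≡.refl = if does (P? w) then 1# else 0#
  ... | no  _    = 0#

  M : ∀ {n} → List (Subset n) → Series
  M π = monomialSum (λ w → compositionOf w ≟ᵇ π)

  N : ∀ {n} → List (Subset n) → Series
  N {n} π = foldr (λ τ F m w → M τ m w + F m w) (λ _ _ → 0#)
                  (filter (_∼? π) (setCompositions n))

  WQSym : Pred Series (c ⊔ ℓ₁)
  WQSym = Span {I = ∃ SetComposition} (λ (n , π , _) → M π)

  SC : Pred Series (c ⊔ ℓ₁)
  SC = Span {I = ∃ SetComposition} (λ (n , π , _) → N π)

module _ (ℝ : Reals) where

  open Reals ℝ hiding (zero)

  Point : ℕ → Set
  Point n = Vector Carrier n

  infix 4 _≋_
  _≋_ : ∀ {n} → Point n → Point n → Set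
  x ≋ y = ∀ i → x i ≈ y i

  origin : ∀ {n} → Point n
  origin _ = 0#

  basis : ∀ {n} → Fin n → Point n
  basis j i = if does (i Fin.≟ j) then 1# else 0#

  conv : ∀ {n} → List (Point n) → Pred (Point n) 0ℓ
  conv V x = ∃ λ (t : Vector Carrier (length V)) →
    (∀ k → 0# ≤ t k) ×
    sum t ≈ 1# ×
    x ≋ (λ i → sum (λ k → t k * lookup V k i))

  simplex : ∀ {n} → Subset n → Pred (Point n) 0ℓ
  simplex {n} J = conv (map basis (filter (_∈? J) (allFin n)))

  dilate : ∀ {n} → Carrier → Pred (Point n) 0ℓ → Pred (Point n) 0ℓ
  dilate a Q x = ∃ λ y → y ∈ Q × x ≋ (λ i → a * y i)

  infixl 6 _⊕_
  _⊕_ : ∀ {n} → Pred (Point n) 0ℓ → Pred (Point n) 0ℓ → Pred (Point n) 0ℓ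
  (Q ⊕ R) x = ∃ λ y → ∃ λ z → y ∈ Q × z ∈ R × x ≋ (λ i → y i + z i)

  minkowskiSum : ∀ {n} → List (Pred (Point n) 0ℓ) → Pred (Point n) 0ℓ
  minkowskiSum = foldr _⊕_ (_≋ origin)

  -- The value at the empty set of a family a : Subset n → ℝ is never used.

  positivePart : ∀ {n} → (Subset n → Carrier) → Pred (Point n) 0ℓ
  positivePart {n} a = minkowskiSum
    (map (λ J → dilate (a J) (simplex J))
         (filter (λ J → nonempty? J ×-dec (0# <? a J)) (allSubsets n)))

  negativePart : ∀ {n} → (Subset n → Carrier) → Pred (Point n) 0ℓ
  negativePart {n} a = minkowskiSum
    (map (λ J → dilate (- a J) (simplex J))
         (filter (λ J → nonempty? J ×-dec (a J <? 0#)) (allSubsets n)))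

  record GeneralizedPermutahedron (n : ℕ) : Set where
    field
      vertices : List (Point n)

    polytope : Pred (Point n) 0ℓ
    polytope = conv vertices

    field
      isMinkowskiDifference : ∃ λ a → negativePart a ⊕ polytope ≐ positivePart a

  -- x ↦ ∑ᵢ f(i) xᵢ
  functional : ∀ {n} → Vec ℕ n → Point n → Carrier
  functional w x = sum (λ i → suc (Vec.lookup w i) ×ℕ x i)

  minimalFace : ∀ {n} → Pred (Point n) 0ℓ → Vec ℕ n → Pred (Point n) 0ℓ
  minimalFace Q w x = x ∈ Q × (∀ y → y ∈ Q → functional w x ≤ functional w y)

  IsPoint : ∀ {n} → Pred (Point n) 0ℓ → Set
  IsPoint Q = ∃ λ p → Q ≐ (_≋ p)

  Generic : ∀ {n} → GeneralizedPermutahedron n → Pred (Vec ℕ n) 0ℓ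
  Generic q w = IsPoint (minimalFace (GeneralizedPermutahedron.polytope q) w)

  -- Genericity is decidable: the minimal face of conv V is a point exactly
  -- when all members of V that minimize the functional coincide.

  private
    module RP = RingProperties ring
    module SR = SetoidReasoning setoid

  0≤⇒≤ : ∀ {x y} → 0# ≤ y - x → x ≤ y
  0≤⇒≤ {x} {y} p = ≤-trans (≤-reflexive (sym (+-identityˡ x)))
    (≤-trans (+-monoˡ-≤ x p) (≤-reflexive (begin
      (y - x) + x    ≈⟨ +-assoc y (- x) x ⟩
      y + (- x + x)  ≈⟨ +-congˡ (-‿inverseˡ x) ⟩
      y + 0#         ≈⟨ +-identityʳ y ⟩
      y              ∎)))
    where open SR

  ≤⇒0≤ : ∀ {x y} → x ≤ y → 0# ≤ y - x
  ≤⇒0≤ {x} p = ≤-trans (≤-reflexive (sym (-‿inverseʳ x))) (+-monoˡ-≤ (- x) p)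

  +-mono-≤ : ∀ {x y u v} → x ≤ y → u ≤ v → x + u ≤ y + v
  +-mono-≤ {x} {y} {u} {v} p q = ≤-trans (+-monoˡ-≤ u p)
    (≤-trans (≤-reflexive (+-comm y u)) (≤-trans (+-monoˡ-≤ y q) (≤-reflexive (+-comm v y))))

  -- A square is non-negative, so 1 is.
  0≤1 : 0# ≤ 1#
  0≤1 with total 0# 1#
  ... | inj₁ p = p
  ... | inj₂ p = ≤-trans (*-nonNegative q q) (≤-reflexive (begin
      (0# - 1#) * (0# - 1#)  ≈⟨ *-cong (+-identityˡ _) (+-identityˡ _) ⟩
      (- 1#) * (- 1#)        ≈⟨ RP.-1*x≈-x (- 1#) ⟩
      - (- 1#)               ≈⟨ RP.-‿involutive 1# ⟩
      1#                     ∎))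
    where
    open SR
    q = ≤⇒0≤ p

  0≉1 : ¬ (0# ≈ 1#)
  0≉1 0≈1 = #-irrefl {0#} refl (invertible⇒# (0# , inv , inv))
    where
    inv : ∀ {x} → x ≈ 1#
    inv {x} = begin
      x       ≈⟨ *-identityˡ x ⟨
      1# * x  ≈⟨ *-congʳ 0≈1 ⟨
      0# * x  ≈⟨ zeroˡ x ⟩
      0#      ≈⟨ 0≈1 ⟩
      1#      ∎
      where open SR

  noZeroDivisors : ∀ {x y} → ¬ (y ≈ 0#) → x * y ≈ 0# → x ≈ 0#
  noZeroDivisors {x} {y} y≉0 xy≈0 with #⇒invertible (≉⇒# y≉0)
  ... | z , _ , yz≈1 = begin
      x                    ≈⟨ *-identityʳ x ⟨
      x * 1#               ≈⟨ *-congˡ yz≈1 ⟨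
      x * ((y - 0#) * z)   ≈⟨ *-congˡ (*-congʳ (trans (+-congˡ RP.-0#≈0#) (+-identityʳ y))) ⟩
      x * (y * z)          ≈⟨ *-assoc x y z ⟨
      x * y * z            ≈⟨ *-congʳ xy≈0 ⟩
      0# * z               ≈⟨ zeroˡ z ⟩
      0#                   ∎
    where open SR

  sum-nonNegative : ∀ {n} (g : Vector Carrier n) → (∀ k → 0# ≤ g k) → 0# ≤ sum g
  sum-nonNegative {zero}  g p = ≤-refl
  sum-nonNegative {suc n} g p = ≤-trans (≤-reflexive (sym (+-identityˡ 0#)))
    (+-mono-≤ (p zero) (sum-nonNegative (g ∘ suc) (p ∘ suc)))

  sum-zero : ∀ {n} (g : Vector Carrier n) → (∀ k → 0# ≤ g k) → sum g ≤ 0# → ∀ k → g k ≈ 0#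
  sum-zero g p s zero = antisym
    (≤-trans (≤-trans (≤-reflexive (sym (+-identityʳ _)))
      (+-mono-≤ ≤-refl (sum-nonNegative (g ∘ suc) (p ∘ suc)))) s)
    (p zero)
  sum-zero g p s (suc k) = sum-zero (g ∘ suc) (p ∘ suc)
    (≤-trans (≤-trans (≤-reflexive (sym (+-identityˡ _))) (+-mono-≤ (p zero) ≤-refl)) s) k

  sum-indicator : ∀ {n} (g : Vector Carrier n) k → sum (λ j → basis k j * g j) ≈ g k
  sum-indicator {suc n} g zero = begin
      1# * g zero + sum (λ j → 0# * g (suc j))
        ≈⟨ +-cong (*-identityˡ _) (sum-cong-≋ (λ j → zeroˡ (g (suc j)))) ⟩
      g zero + sum {n} (λ _ → 0#)  ≈⟨ +-congˡ (sum-replicate-zero n) ⟩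
      g zero + 0#                  ≈⟨ +-identityʳ _ ⟩
      g zero                       ∎
    where open SR
  sum-indicator {suc n} g (suc k) = begin
      0# * g zero + sum (λ j → basis k j * g (suc j))
        ≈⟨ +-cong (zeroˡ _) (sum-indicator (g ∘ suc) k) ⟩
      0# + g (suc k)  ≈⟨ +-identityˡ _ ⟩
      g (suc k)       ∎
    where open SR

  sum-basis : ∀ {n} (k : Fin n) → sum (basis k) ≈ 1#
  sum-basis k = trans (sum-cong-≋ (λ j → sym (*-identityʳ (basis k j)))) (sum-indicator (λ _ → 1#) k)

  basis-nonNegative : ∀ {n} (k j : Fin n) → 0# ≤ basis k j
  basis-nonNegative k j with does (j Fin.≟ k)
  ... | true  = 0≤1
  ... | false = ≤-refl

  lookup∈conv : ∀ {n} (V : List (Point n)) k → lookup V k ∈ conv V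
  lookup∈conv V k = basis k , basis-nonNegative k , sum-basis k ,
    λ i → sym (sum-indicator (λ j → lookup V j i) k)

  functional-combination : ∀ {m n} (w : Vec ℕ n) (t : Vector Carrier m) (v : Fin m → Point n) x →
    x ≋ (λ i → sum (λ k → t k * v k i)) →
    functional w x ≈ sum (λ k → t k * functional w (v k))
  functional-combination {m} {n} w t v x e = begin
      functional w x
        ≈⟨ sum-cong-≋ (λ i → trans (weight i (x i)) (*-congˡ (e i))) ⟩
      sum (λ i → f i * sum (λ k → t k * v k i))
        ≈⟨ sum-cong-≋ (λ i → *-distribˡ-sum (f i) (λ k → t k * v k i)) ⟩
      sum (λ i → sum (λ k → f i * (t k * v k i)))
        ≈⟨ ∑-comm (λ i k → f i * (t k * v k i)) ⟩
      sum (λ k → sum (λ i → f i * (t k * v k i)))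
        ≈⟨ sum-cong-≋ (λ k → sum-cong-≋ (λ i → swap i (t k) (v k i))) ⟩
      sum (λ k → sum (λ i → t k * (suc (Vec.lookup w i) ×ℕ v k i)))
        ≈⟨ sum-cong-≋ (λ k → *-distribˡ-sum (t k) (λ i → suc (Vec.lookup w i) ×ℕ v k i)) ⟨
      sum (λ k → t k * functional w (v k)) ∎
    where
    open SR
    f : Fin n → Carrier
    f i = suc (Vec.lookup w i) ×ℕ 1#
    weight : ∀ i y → suc (Vec.lookup w i) ×ℕ y ≈ f i * y
    weight i y = sym (trans (×-assoc-* (suc (Vec.lookup w i)) 1# y)
      (×-congʳ (suc (Vec.lookup w i)) (*-identityˡ y)))
    swap : ∀ i b y → f i * (b * y) ≈ b * (suc (Vec.lookup w i) ×ℕ y)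
    swap i b y = begin
      f i * (b * y)                      ≈⟨ *-assoc (f i) b y ⟨
      f i * b * y                        ≈⟨ *-congʳ (*-comm (f i) b) ⟩
      b * f i * y                        ≈⟨ *-assoc b (f i) y ⟩
      b * (f i * y)                      ≈⟨ *-congˡ (weight i y) ⟨
      b * (suc (Vec.lookup w i) ×ℕ y)    ∎

  functional-cong : ∀ {n} (w : Vec ℕ n) {x y : Point n} → x ≋ y → functional w x ≈ functional w y
  functional-cong w e = sum-cong-≋ (λ i → ×-congʳ (suc (Vec.lookup w i)) (e i))

  argmin : ∀ {n} (g : Vector Carrier (suc n)) → ∃ λ k → ∀ j → g k ≤ g j
  argmin {zero} g = zero , λ { zero → ≤-refl }
  argmin {suc n} g with argmin (g ∘ suc)
  ... | k , min with total (g zero) (g (suc k))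
  ...   | inj₁ p = zero , λ { zero → ≤-refl ; (suc j) → ≤-trans p (min j) }
  ...   | inj₂ p = suc k , λ { zero → p ; (suc j) → min j }

  isPoint? : ∀ {n} (V : List (Point n)) (w : Vec ℕ n) → Dec (IsPoint (minimalFace (conv V) w))
  isPoint? [] w = no λ (p , _ , ⊇) → case-empty (proj₁ (⊇ {p} (λ _ → refl)))
    where
    case-empty : ∀ {p} → ¬ (p ∈ conv [])
    case-empty (_ , _ , 0≈1 , _) = 0≉1 0≈1
  isPoint? {n} V@(_ ∷ _) w =
    map′ point coincide
      (Fin.all? (λ k → (g k ≤? g k₀) →-dec Fin.all? (λ i → v k i ≟ v k₀ i)))
    where
    v : Fin (length V) → Point n
    v = lookup V

    g : Fin (length V) → Carrier
    g = functional w ∘ v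

    k₀ : Fin (length V)
    k₀ = proj₁ (argmin g)

    g-min : ∀ k → g k₀ ≤ g k
    g-min = proj₂ (argmin g)

    average : ∀ (t : Vector Carrier (length V)) a → sum t ≈ 1# → sum (λ k → t k * a) ≈ a
    average t a s = trans (sym (*-distribʳ-sum a t)) (trans (*-congʳ s) (*-identityˡ a))

    excess : ∀ x ((t , _) : x ∈ conv V) → g k₀ + sum (λ k → t k * (g k - g k₀)) ≈ functional w x
    excess x (t , _ , s , e) = begin
        g k₀ + sum (λ k → t k * (g k - g k₀))
          ≈⟨ +-congʳ (average t (g k₀) s) ⟨
        sum (λ k → t k * g k₀) + sum (λ k → t k * (g k - g k₀))
          ≈⟨ ∑-distrib-+ (λ k → t k * g k₀) (λ k → t k * (g k - g k₀)) ⟨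
        sum (λ k → t k * g k₀ + t k * (g k - g k₀))
          ≈⟨ sum-cong-≋ (λ k → trans (sym (distribˡ (t k) (g k₀) (g k - g k₀))) (*-congˡ (cancel (g k)))) ⟩
        sum (λ k → t k * g k)
          ≈⟨ functional-combination w t v x e ⟨
        functional w x ∎
      where
      open SR
      cancel : ∀ y → g k₀ + (y - g k₀) ≈ y
      cancel y = trans (+-comm _ _)
        (trans (+-assoc y _ _) (trans (+-congˡ (-‿inverseˡ (g k₀))) (+-identityʳ y)))

    term-nonNegative : ∀ x ((t , _) : x ∈ conv V) k → 0# ≤ t k * (g k - g k₀)
    term-nonNegative x (t , p , _) k = *-nonNegative (p k) (≤⇒0≤ (g-min k))

    lower-bound : ∀ x → x ∈ conv V → g k₀ ≤ functional w x
    lower-bound x x∈ =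
      ≤-trans (≤-reflexive (sym (+-identityʳ (g k₀))))
        (≤-trans (+-mono-≤ ≤-refl (sum-nonNegative _ (term-nonNegative x x∈)))
          (≤-reflexive (excess x x∈)))

    point : (∀ k → g k ≤ g k₀ → v k ≋ v k₀) → IsPoint (minimalFace (conv V) w)
    point coin = v k₀ , (λ {x} → ⊆ x) , (λ {x} → ⊇ x)
      where
      ⊆ : ∀ x → x ∈ minimalFace (conv V) w → x ≋ v k₀
      ⊆ x (x∈@(t , p , s , e) , min) i =
        trans (e i) (trans (sum-cong-≋ same) (average t (v k₀ i) s))
        where
        gap≤0 : sum (λ k → t k * (g k - g k₀)) ≤ 0#
        gap≤0 = ≤-trans (≤-reflexive (begin
            d                 ≈⟨ +-identityʳ d ⟨
            d + 0#            ≈⟨ +-congˡ (-‿inverseʳ (g k₀)) ⟨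
            d + (g k₀ - g k₀) ≈⟨ +-assoc d (g k₀) (- g k₀) ⟨
            d + g k₀ - g k₀   ≈⟨ +-congʳ (trans (+-comm d (g k₀)) (excess x x∈)) ⟩
            functional w x - g k₀ ∎))
          (≤-trans (+-monoˡ-≤ (- g k₀) (min (v k₀) (lookup∈conv V k₀)))
            (≤-reflexive (-‿inverseʳ (g k₀))))
          where
          open SR
          d = sum (λ k → t k * (g k - g k₀))
        same : ∀ k → t k * v k i ≈ t k * v k₀ i
        same k with g k ≤? g k₀
        ... | yes q = *-congˡ (coin k q i)
        ... | no ¬q = trans (*-congʳ t≈0) (trans (zeroˡ _) (sym (trans (*-congʳ t≈0) (zeroˡ _))))
          where
          t≈0 : t k ≈ 0#
          t≈0 = noZeroDivisors
            (λ z → ¬q (≤-reflexive (RP.x∙y⁻¹≈ε⇒x≈y (g k) (g k₀) z)))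
            (sum-zero _ (term-nonNegative x x∈) gap≤0 k)
      ⊇ : ∀ x → x ≋ v k₀ → x ∈ minimalFace (conv V) w
      ⊇ x e with lookup∈conv V k₀
      ... | t , p , s , e′ =
        (t , p , s , λ i → trans (e i) (e′ i)) ,
        λ y y∈ → ≤-trans (≤-reflexive (functional-cong w e)) (lower-bound y y∈)

    coincide : IsPoint (minimalFace (conv V) w) → ∀ k → g k ≤ g k₀ → v k ≋ v k₀
    coincide (p , ⊆ , _) k q i = trans (equals k q i) (sym (equals k₀ ≤-refl i))
      where
      equals : ∀ k → g k ≤ g k₀ → v k ≋ p
      equals k q = ⊆ (lookup∈conv V k , λ y y∈ → ≤-trans q (lower-bound y y∈))

  generic? : ∀ {n} (q : GeneralizedPermutahedron n) → Decidable (Generic q)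
  generic? q = isPoint? (GeneralizedPermutahedron.vertices q)

module _ {c ℓ₁ ℓ₂ : Level} (K : HeytingField c ℓ₁ ℓ₂) (ℝ : Reals) where

  open HeytingField K using (Carrier)

  -- A list of terms presents an element of the free vector space.  Several
  -- lists, and several vertex lists of one polytope, present the same
  -- element; Υ does not distinguish them, as Generic refers to the polytope
  -- only through its points.

  GP : Set c
  GP = List (Carrier × ∃ (GeneralizedPermutahedron ℝ))

  Υ : GP → Series K
  Υ = linearCombination K (λ (n , q) → monomialSum K (generic? ℝ q))

  Image-Υ : Pred (Series K) (c ⊔ ℓ₁)
  Image-Υ F = ∃ λ g → _≈ˢ_ K F (Υ g)

{-# OPTIONS --safe #-}
module Submission where

-- Write a_J for the coefficients of q.  Taking minimal faces commutes with
-- Minkowski sums, and the minimal face of s_J for f is s_{J_f}, where J_f is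
-- the set of minimizers of f on J.  A coordinate xᵢ has on this face a range
-- of width 1 if f is tied at i (i ∈ J_f and #J_f ≥ 2) and of width 0
-- otherwise.  Hence f is q-generic iff for every i the a_J with f tied at i on
-- J sum to 0.  The relation ∼ determines all ties, so Υ(q) is a sum of
-- monomials over a union of ∼-classes, i.e. a sum of N's.
--
-- Conversely, for q_π = ∑ s_J over all J with #J_π = 1, Υ(q_π) is the sum of
-- the N_[τ] with #J_π = 1 ⇒ #J_τ = 1 for all J.  This system is unitriangular
-- and is solved for N_[π] by induction on the number of J with #J_π ≠ 1.
open import Defs
open import Algebra.Apartness.Bundles using (HeytingField; HeytingCommutativeRing)
open import Algebra.Bundles using (CommutativeRing)
import Algebra.Properties.CommutativeMonoid.Mult as CommutativeMultiples
import Algebra.Properties.CommutativeSemigroup as CommutativeSemigroupProperties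
import Algebra.Properties.Ring as RingProperties
import Algebra.Properties.Semiring.Mult as Multiples
open import Data.Bool.Base using (true; false; if_then_else_)
open import Data.Empty using (⊥-elim)
open import Data.Fin.Base using (Fin; zero; suc)
import Data.Fin.Properties as Fin
open import Data.Fin.Subset using (Subset; inside; outside; Nonempty; Empty; _∩_; _∪_; ⋃; ∣_∣; ⁅_⁆) renaming (_∈_ to _∈ᶠ_)
import Data.Fin.Subset.Properties as Sub
open import Data.Fin.Subset.Properties using (nonempty?; _∈?_)
open import Data.List.Base using (List; []; _∷_; _++_; map; filter; foldr; length; lookup; allFin; upTo; applyUpTo; deduplicate; cartesianProductWith)
import Data.List.Extrema.Nat as Extrema
import Data.List.Membership.Propositional as List
import Data.List.Membership.Propositional.Properties as List
import Data.List.Properties as List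
open import Data.List.Relation.Binary.Disjoint.Propositional using (Disjoint)
open import Data.List.Relation.Unary.All as All using (All; []; _∷_; all?)
import Data.List.Relation.Unary.All.Properties as All
open import Data.List.Relation.Unary.AllPairs as AllPairs using (AllPairs; []; _∷_)
import Data.List.Relation.Unary.AllPairs.Properties as AllPairs
open import Data.List.Relation.Unary.Any as Any using (Any; here; there)
import Data.List.Relation.Unary.Any.Properties as Any
open import Data.List.Relation.Unary.Unique.DecSetoid.Properties using (deduplicate-!)
open import Data.List.Relation.Unary.Unique.Propositional using (Unique)
import Data.List.Relation.Unary.Unique.Propositional.Properties as Unique
open import Data.Nat.Base as ℕ using (ℕ; zero; suc; z≤n; s≤s)
import Data.Nat.Properties as ℕ
open import Data.Product.Base using (∃; _×_; _,_; proj₁; proj₂; map₂)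
open import Data.Sum.Base using (inj₁; inj₂)
open import Data.Vec.Base as Vec using (Vec; []; _∷_; toList)
open import Data.Vec.Functional using (Vector)
import Data.Vec.Membership.Propositional.Properties as Vec
import Data.Vec.Properties as Vec
open import Function.Base using (_∘_; id; case_of_)
open import Function.Bundles using (_⇔_; mk⇔; Equivalence)
open import Level using (Level; 0ℓ)
open import Relation.Binary.Bundles using (DecSetoid)
open import Relation.Binary.Definitions using (tri<; tri≈; tri>)
open import Relation.Binary.PropositionalEquality as ≡ using (_≡_; _≢_)
import Relation.Binary.Reasoning.Setoid as SetoidReasoning
open import Relation.Nullary.Decidable using (Dec; yes; no; does; map′; ¬?; decidable-stable; dec-true; dec-false; _×-dec_; _→-dec_)
open import Relation.Nullary.Negation using (¬_; contradiction)
open import Relation.Unary using (Pred; Decidable; _∈_; _≐_)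

open Equivalence using (to; from)

-- Set compositions and ties

-- The points of a Minkowski difference q have no direct description; all that is known is B + q =
-- A, with A and B the sums of simplices with positive and negative coefficients. Coordinate ranges
-- survive this: their endpoints add under Minkowski sums, so those of B can be subtracted from
-- those of A, and a non-empty face is a point as soon as each coordinate is constant on it. On the
-- combinatorial side, set compositions and words are compared through the minimizers that they
-- select on each set. Genericity, `∼` and the order behind the induction thereby all become
-- statements about ties. The coefficients of q_π are 0 or 1 so that widths cannot cancel: a word is
-- generic exactly when it is untied on every chosen set. In general, opposite signs may hide ties.

allSubsets-complete : ∀ {n} (A : Subset n) → A List.∈ allSubsets n
allSubsets-complete []            = here ≡.refl
allSubsets-complete (inside  ∷ A) = List.∈-++⁺ˡ (List.∈-map⁺ _ (allSubsets-complete A))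
allSubsets-complete (outside ∷ A) =
  List.∈-++⁺ʳ (map (inside ∷_) (allSubsets _)) (List.∈-map⁺ _ (allSubsets-complete A))

allSubsets-unique : ∀ n → Unique (allSubsets n)
allSubsets-unique zero    = [] ∷ []
allSubsets-unique (suc n) = Unique.++⁺
  (Unique.map⁺ Vec.∷-injectiveʳ (allSubsets-unique n))
  (Unique.map⁺ Vec.∷-injectiveʳ (allSubsets-unique n))
  λ (p , q) → case (List.∈-map⁻ _ p , List.∈-map⁻ _ q) of
    λ { ((_ , _ , ≡.refl) , (_ , _ , ())) }

listsUpTo-complete : ∀ {A : Set} {xs ys : List A} k →
  length ys ℕ.≤ k → All (List._∈ xs) ys → ys List.∈ listsUpTo k xs
listsUpTo-complete {ys = []}    zero    _       _        = here ≡.refl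
listsUpTo-complete {ys = []}    (suc k) _       _        = here ≡.refl
listsUpTo-complete {xs = xs} {ys = _ ∷ _} (suc k) (s≤s l) (p ∷ ps) =
  there (List.∈-concatMap⁺ (λ x → map (x ∷_) (listsUpTo k xs))
    (Any.map (λ { ≡.refl → List.∈-map⁺ _ (listsUpTo-complete k l ps) }) p))

listsUpTo-unique : ∀ {A : Set} {xs : List A} k → Unique xs → Unique (listsUpTo k xs)
listsUpTo-unique zero    _   = [] ∷ []
listsUpTo-unique {xs = xs} (suc k) xs! =
  All.tabulate (λ p → λ { ≡.refl → []∉ xs (List.∈-concatMap⁻ _ {xs = xs} p) }) ∷
  Unique.concat⁺
    (All.map⁺ (All.tabulate λ _ →
      Unique.map⁺ (λ { ≡.refl → ≡.refl }) (listsUpTo-unique k xs!)))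
    (AllPairs.map⁺ (AllPairs.map disjoint xs!))
  where
  []∉ : ∀ ys → ¬ Any (λ x → [] List.∈ map (x ∷_) (listsUpTo k xs)) ys
  []∉ (_ ∷ ys) (here p)  = case List.∈-map⁻ _ p of λ { (_ , _ , ()) }
  []∉ (_ ∷ ys) (there p) = []∉ ys p
  disjoint : ∀ {x y} → x ≢ y →
    Disjoint (map (x ∷_) (listsUpTo k xs)) (map (y ∷_) (listsUpTo k xs))
  disjoint x≢y (p , q) with List.∈-map⁻ _ p | List.∈-map⁻ _ q
  ... | _ , _ , ≡.refl | _ , _ , ≡.refl = x≢y ≡.refl

lookup-disjoint : ∀ {n} {π : List (Subset n)} → AllPairs (λ S T → Empty (S ∩ T)) π →
  ∀ k l {i} → i ∈ᶠ lookup π k → i ∈ᶠ lookup π l → k ≡ l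
lookup-disjoint (_ ∷ _)  zero    zero    _ _ = ≡.refl
lookup-disjoint (d ∷ _)  zero    (suc l) p q =
  ⊥-elim (All.lookup d (List.∈-lookup l) (_ , Sub.x∈p∩q⁺ (p , q)))
lookup-disjoint (d ∷ _)  (suc k) zero    p q =
  ⊥-elim (All.lookup d (List.∈-lookup k) (_ , Sub.x∈p∩q⁺ (q , p)))
lookup-disjoint (_ ∷ ds) (suc k) (suc l) p q = ≡.cong suc (lookup-disjoint ds k l p q)

-- Choosing a member of each block is injective by disjointness. This justifies the cutoff at length
-- n in `setCompositions`.
length-blocks : ∀ {n} {π : List (Subset n)} → IsSetComposition π → length π ℕ.≤ n
length-blocks {π = π} (isSetComposition ne disj _) = Fin.injective⇒≤ {f = member} injective
  where
  member : Fin (length π) → Fin _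
  member k = proj₁ (All.lookup ne (List.∈-lookup k))
  injective : ∀ {k l} → member k ≡ member l → k ≡ l
  injective {k} {l} e = lookup-disjoint disj k l
    (proj₂ (All.lookup ne (List.∈-lookup k)))
    (≡.subst (_∈ᶠ lookup π l) (≡.sym e) (proj₂ (All.lookup ne (List.∈-lookup l))))

setCompositions-complete : ∀ {n} {π : List (Subset n)} → IsSetComposition π → π List.∈ setCompositions n
setCompositions-complete {n} π-comp = List.∈-filter⁺ isSetComposition?
  (listsUpTo-complete n (length-blocks π-comp) (All.tabulate λ {A} _ → allSubsets-complete A)) π-comp

setCompositions-sound : ∀ {n} {π : List (Subset n)} → π List.∈ setCompositions n → IsSetComposition π
setCompositions-sound {n} p = proj₂ (List.∈-filter⁻ isSetComposition? {xs = listsUpTo n (allSubsets n)} p)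

-- `N` adds one `M` per entry of this list, so a repeated entry would spoil its coefficients.
setCompositions-unique : ∀ n → Unique (setCompositions n)
setCompositions-unique n = Unique.filter⁺ isSetComposition? (listsUpTo-unique n (allSubsets-unique n))

∈⋃⁺ : ∀ {n} {π : List (Subset n)} {S i} → S List.∈ π → i ∈ᶠ S → i ∈ᶠ ⋃ π
∈⋃⁺ (here ≡.refl) q = Sub.x∈p∪q⁺ (inj₁ q)
∈⋃⁺ (there p)     q = Sub.x∈p∪q⁺ (inj₂ (∈⋃⁺ p q))

-- Words and their set compositions

∈-preimage : ∀ {n} (w : Vec ℕ n) i → i ∈ᶠ preimage w (Vec.lookup w i)
∈-preimage w i = Vec.lookup⇒[]= i _ (≡.trans (Vec.lookup-map i _ w)
  (dec-true (Vec.lookup w i ℕ.≟ Vec.lookup w i) ≡.refl))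

preimage-∈ : ∀ {n} (w : Vec ℕ n) {k i} → i ∈ᶠ preimage w k → Vec.lookup w i ≡ k
preimage-∈ w {k} {i} p = decidable-stable (Vec.lookup w i ℕ.≟ k) λ ≢k → contradiction
  (≡.trans (≡.sym (Vec.[]=⇒lookup p))
    (≡.trans (Vec.lookup-map i (λ x → does (x ℕ.≟ k)) w) (dec-false (Vec.lookup w i ℕ.≟ k) ≢k)))
  λ ()

letter<bound : ∀ {n} (w : Vec ℕ n) i → Vec.lookup w i ℕ.< suc (Extrema.max 0 (toList w))
letter<bound w i = s≤s (All.lookup (Extrema.xs≤max 0 (toList w))
  (Vec.∈-toList⁺ (Vec.∈-lookup i w)))

compositionOf-isSetComposition : ∀ {n} (w : Vec ℕ n) → IsSetComposition (compositionOf w)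
compositionOf-isSetComposition w = isSetComposition
  (All.all-filter nonempty? (map (preimage w) (upTo bound)))
  (AllPairs.filter⁺ nonempty? (AllPairs.map⁺ (AllPairs.map
    (λ k≢l (i , p) → let (p₁ , p₂) = Sub.x∈p∩q⁻ _ _ p in
      k≢l (≡.trans (≡.sym (preimage-∈ w p₁)) (preimage-∈ w p₂)))
    (Unique.upTo⁺ bound))))
  (Sub.⊆-antisym Sub.⊆⊤ λ {i} _ → ∈⋃⁺
    (List.∈-filter⁺ nonempty?
      (List.∈-map⁺ (preimage w) (List.∈-upTo⁺ (letter<bound w i)))
      (i , ∈-preimage w i))
    (∈-preimage w i))
  where
  bound = suc (Extrema.max 0 (toList w))

-- Minimizers and ties

Min : ∀ {n} → (Fin n → ℕ) → Subset n → Fin n → Set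
Min f A i = i ∈ᶠ A × ∀ j → j ∈ᶠ A → f i ℕ.≤ f j

Min? : ∀ {n} (f : Fin n → ℕ) A → Decidable (Min f A)
Min? f A i = (i ∈? A) ×-dec Fin.all? (λ j → (j ∈? A) →-dec (f i ℕ.≤? f j))

Tied : ∀ {n} → (Fin n → ℕ) → Subset n → Fin n → Set
Tied f A i = Min f A i × ∃ λ j → Min f A j × i ≢ j

Tied? : ∀ {n} (f : Fin n → ℕ) A → Decidable (Tied f A)
Tied? f A i = Min? f A i ×-dec Fin.any? (λ j → Min? f A j ×-dec ¬? (i Fin.≟ j))

Untied : ∀ {n} → (Fin n → ℕ) → Subset n → Set
Untied f A = ∀ i → ¬ Tied f A i

minimizer : ∀ {n} (f : Fin n → ℕ) {A} → Nonempty A → ∃ (Min f A)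
-- The default value `i` of `argmin` is itself a member of A, so the result lies in A even if it is
-- the default.
minimizer f {A} (i , i∈A) = Extrema.argmin f i elements ,
  Extrema.argmin-all f i∈A (All.tabulate (proj₂ ∘ List.∈-filter⁻ (_∈? A) {xs = allFin _})) ,
  λ j j∈A → All.lookup (Extrema.f[argmin]≤f[xs] i elements)
    (List.∈-filter⁺ (_∈? A) (List.∈-allFin j) j∈A)
  where
  elements = filter (_∈? A) (allFin _)

-- Only the order of the values of f matters here. So the letters of a word and the block indices of
-- a set composition can be handled alike, and A_π becomes a set of minimizers.
Represents : ∀ {n} → List (Subset n) → (Fin n → ℕ) → Set
Represents π f = ∀ {A} → Nonempty A → ∀ {i} → i ∈ᶠ A ↾ π ⇔ Min f A i

compositionOf-represents : ∀ {n} (w : Vec ℕ n) → Represents (compositionOf w) (Vec.lookup w)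
compositionOf-represents {n} w {A} A≢∅ {i} =
  go (suc (Extrema.max 0 (toList w))) id 0 (λ _ → ≡.refl) (λ _ _ → z≤n) (λ i _ → letter<bound w i)
  where
  f = Vec.lookup w
  -- The letters k, ..., k + m - 1 remain to be scanned, and all values of f on A lie among them.
  -- The function `g` is carried along because `applyUpTo` advances by composing with `suc`.
  go : ∀ m g k → (∀ x → g x ≡ k ℕ.+ x) → (∀ i → i ∈ᶠ A → k ℕ.≤ f i) →
    (∀ i → i ∈ᶠ A → f i ℕ.< k ℕ.+ m) →
    i ∈ᶠ A ↾ filter nonempty? (map (preimage w) (applyUpTo g m)) ⇔ Min f A i
  go zero g k _ lower upper = let (j , j∈A) = A≢∅ in
    ⊥-elim (ℕ.<⇒≱ (upper j j∈A) (≡.subst (ℕ._≤ f j) (≡.sym (ℕ.+-identityʳ k)) (lower j j∈A)))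
  go (suc m) g k g≡ lower upper = split
    where
    g0 : g 0 ≡ k
    g0 = ≡.trans (g≡ 0) (ℕ.+-identityʳ k)
    k≡ : ∀ {i} → i ∈ᶠ preimage w (g 0) → f i ≡ k
    k≡ p = ≡.trans (preimage-∈ w p) g0
    ∈k : ∀ {i} → f i ≡ k → i ∈ᶠ preimage w (g 0)
    ∈k {i} e = ≡.subst (λ k → i ∈ᶠ preimage w k) (≡.trans e (≡.sym g0)) (∈-preimage w i)
    rest : (∀ i → i ∈ᶠ A → f i ≢ k) →
      i ∈ᶠ A ↾ filter nonempty? (map (preimage w) (applyUpTo (g ∘ suc) m)) ⇔ Min f A i
    rest ne = go m (g ∘ suc) (suc k) (λ x → ≡.trans (g≡ (suc x)) (ℕ.+-suc k x))
      (λ i i∈A → ℕ.≤∧≢⇒< (lower i i∈A) (ne i i∈A ∘ ≡.sym))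
      (λ i i∈A → ≡.subst (f i ℕ.<_) (ℕ.+-suc k m) (upper i i∈A))
    split : i ∈ᶠ A ↾ filter nonempty? (preimage w (g 0) ∷ map (preimage w) (applyUpTo (g ∘ suc) m))
      ⇔ Min f A i
    split with nonempty? (preimage w (g 0))
    -- Letter k is skipped either because it does not occur at all or because its block misses A. In
    -- both cases f avoids k on A, which raises the lower bound.
    ... | no  empty = rest λ i _ e → empty (i , ∈k e)
    ... | yes _ with nonempty? (A ∩ preimage w (g 0))
    ...   | no  empty = rest λ i i∈A e → empty (i , Sub.x∈p∩q⁺ (i∈A , ∈k e))
    ...   | yes (l , l∈) = mk⇔
            (λ p → let (i∈A , q) = Sub.x∈p∩q⁻ A _ p in
              i∈A , λ j j∈A → ≡.subst (ℕ._≤ f j) (≡.sym (k≡ q)) (lower j j∈A))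
            (λ (i∈A , min) → let (l∈A , q) = Sub.x∈p∩q⁻ A _ l∈ in
              Sub.x∈p∩q⁺ (i∈A , ∈k (ℕ.≤-antisym (≡.subst (f i ℕ.≤_) (k≡ q) (min l l∈A)) (lower i i∈A))))

-- Words for given set compositions

rank : ∀ {n} → List (Subset n) → Fin n → ℕ
rank []      i = 0
rank (S ∷ π) i = if does (i ∈? S) then 0 else suc (rank π i)

rank-∈ : ∀ {n S i} (π : List (Subset n)) → i ∈ᶠ S → rank (S ∷ π) i ≡ 0
rank-∈ {S = S} {i} π p rewrite dec-true (i ∈? S) p = ≡.refl

rank-∉ : ∀ {n S i} (π : List (Subset n)) → ¬ i ∈ᶠ S → rank (S ∷ π) i ≡ suc (rank π i)
rank-∉ {S = S} {i} π p rewrite dec-false (i ∈? S) p = ≡.refl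

-- Both sides look for the first block that A meets. The hypothesis is that π covers A, not all of
-- [n], because only this passes to the tail: a set A that misses S is covered by the remaining
-- blocks.
rank-represents′ : ∀ {n} (π : List (Subset n)) {A} → Nonempty A → (∀ i → i ∈ᶠ A → i ∈ᶠ ⋃ π) →
  ∀ {i} → i ∈ᶠ A ↾ π ⇔ Min (rank π) A i
rank-represents′ []      (i , i∈A) cover = ⊥-elim (Sub.∉⊥ (cover i i∈A))
rank-represents′ (S ∷ π) {A} A≢∅ cover {i} with nonempty? (A ∩ S)
... | yes (l , l∈) = mk⇔
      (λ p → let (i∈A , i∈S) = Sub.x∈p∩q⁻ A S p in
        i∈A , λ j _ → ≡.subst (ℕ._≤ rank (S ∷ π) j) (≡.sym (rank-∈ π i∈S)) z≤n)
      (λ (i∈A , min) → Sub.x∈p∩q⁺ (i∈A , decidable-stable (i ∈? S) λ i∉S →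
        let (l∈A , l∈S) = Sub.x∈p∩q⁻ A S l∈ in
        case ≡.subst₂ ℕ._≤_ (rank-∉ π i∉S) (rank-∈ π l∈S) (min l l∈A) of λ ()))
... | no empty = mk⇔
      (λ p → let (i∈A , min) = to ih p in
        i∈A , λ j j∈A → ≡.subst₂ ℕ._≤_ (≡.sym (rank-suc i∈A)) (≡.sym (rank-suc j∈A)) (s≤s (min j j∈A)))
      (λ (i∈A , min) → from ih (i∈A , λ j j∈A →
        ℕ.s≤s⁻¹ (≡.subst₂ ℕ._≤_ (rank-suc i∈A) (rank-suc j∈A) (min j j∈A))))
  where
  ∉S : ∀ {i} → i ∈ᶠ A → ¬ i ∈ᶠ S
  ∉S i∈A i∈S = empty (_ , Sub.x∈p∩q⁺ (i∈A , i∈S))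
  rank-suc : ∀ {i} → i ∈ᶠ A → rank (S ∷ π) i ≡ suc (rank π i)
  rank-suc i∈A = rank-∉ π (∉S i∈A)
  ih = rank-represents′ π A≢∅ λ i i∈A → case Sub.x∈p∪q⁻ S (⋃ π) (cover i i∈A) of
    λ { (inj₁ i∈S) → contradiction i∈S (∉S i∈A) ; (inj₂ q) → q }

-- A section of `compositionOf` up to `∼`: through it a property of words can be tested on set
-- compositions.
rankWord : ∀ {n} → List (Subset n) → Vec ℕ n
rankWord π = Vec.tabulate (rank π)

rankWord-represents : ∀ {n} {π : List (Subset n)} → IsSetComposition π →
  Represents π (Vec.lookup (rankWord π))
rankWord-represents {π = π} (isSetComposition _ _ covering) A≢∅ = mk⇔
  (λ p → map₂ (λ min j j∈A → ≡.subst₂ ℕ._≤_ (≡.sym (look _)) (≡.sym (look j)) (min j j∈A)) (to r p))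
  (λ q → from r (map₂ (λ min j j∈A → ≡.subst₂ ℕ._≤_ (look _) (look j) (min j j∈A)) q))
  where
  look = Vec.lookup∘tabulate (rank π)
  r = λ {i} → rank-represents′ π A≢∅ (λ i _ → ≡.subst (i ∈ᶠ_) (≡.sym covering) Sub.∈⊤) {i}

∣∣≡1⁺ : ∀ {n} {S : Subset n} {i} → i ∈ᶠ S → (∀ j → j ∈ᶠ S → i ≡ j) → ∣ S ∣ ≡ 1
∣∣≡1⁺ {S = S} {i} i∈S eq = ≡.trans (≡.cong ∣_∣ S≡⁅i⁆) (Sub.∣⁅x⁆∣≡1 i)
  where
  S≡⁅i⁆ : S ≡ ⁅ i ⁆
  S≡⁅i⁆ = Sub.⊆-antisym
    (λ {j} j∈S → ≡.subst (_∈ᶠ ⁅ i ⁆) (eq j j∈S) (Sub.x∈⁅x⁆ i))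
    (λ p → ≡.subst (_∈ᶠ S) (≡.sym (Sub.x∈⁅y⁆⇒x≡y i p)) i∈S)

∣∣≡1⁻ : ∀ {n} {S : Subset n} {i j} → ∣ S ∣ ≡ 1 → i ∈ᶠ S → j ∈ᶠ S → i ≡ j
∣∣≡1⁻ {S = S} {i} {j} e i∈S j∈S = decidable-stable (i Fin.≟ j) λ i≢j →
  ℕ.<-irrefl (≡.trans (Sub.∣⁅x⁆∣≡1 i) (≡.sym e)) (Sub.p⊂q⇒∣p∣<∣q∣
    ((λ p → ≡.subst (_∈ᶠ S) (≡.sym (Sub.x∈⁅y⁆⇒x≡y i p)) i∈S) ,
     j , j∈S , λ p → i≢j (≡.sym (Sub.x∈⁅y⁆⇒x≡y i p))))

-- A_π is the set of minimizers of f on A. It is non-empty, so its size differs from 1 exactly when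
-- it has two distinct members.
∣↾∣≡1⇔Untied : ∀ {n} {π : List (Subset n)} {f} → Represents π f →
  ∀ {A} → Nonempty A → ∣ A ↾ π ∣ ≡ 1 ⇔ Untied f A
∣↾∣≡1⇔Untied {f = f} r {A} A≢∅ = mk⇔
  (λ e i (p , j , q , i≢j) → i≢j (∣∣≡1⁻ e (from (r A≢∅) p) (from (r A≢∅) q)))
  (λ untied → let (i , p) = minimizer f A≢∅ in
    ∣∣≡1⁺ (from (r A≢∅) p) λ j q → decidable-stable (i Fin.≟ j) λ i≢j →
      untied i (p , j , to (r A≢∅) q , i≢j))

strictMin⇒Untied : ∀ {n} {f : Fin n → ℕ} {A k} → k ∈ᶠ A →
  (∀ l → l ∈ᶠ A → l ≢ k → f k ℕ.< f l) → Untied f A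
strictMin⇒Untied {f = f} {A} {k} k∈A strict i (p , j , q , i≢j) = i≢j (≡.trans (is-k p) (≡.sym (is-k q)))
  where
  is-k : ∀ {i} → Min f A i → i ≡ k
  is-k {i} (i∈A , min) = decidable-stable (i Fin.≟ k) λ i≢k → ℕ.<⇒≱ (strict i i∈A i≢k) (min k k∈A)

triple : ∀ {n} → Fin n → Fin n → Fin n → Subset n
triple i j k = ⁅ i ⁆ ∪ (⁅ j ⁆ ∪ ⁅ k ⁆)

module _ {n} {i j k : Fin n} where

  triple₁ : i ∈ᶠ triple i j k
  triple₁ = Sub.x∈p∪q⁺ (inj₁ (Sub.x∈⁅x⁆ i))

  triple₂ : j ∈ᶠ triple i j k
  triple₂ = Sub.x∈p∪q⁺ (inj₂ (Sub.x∈p∪q⁺ (inj₁ (Sub.x∈⁅x⁆ j))))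

  triple₃ : k ∈ᶠ triple i j k
  triple₃ = Sub.x∈p∪q⁺ (inj₂ (Sub.x∈p∪q⁺ (inj₂ (Sub.x∈⁅x⁆ k))))

  triple-elim : ∀ {p} (P : Pred (Fin n) p) → P i → P j → P k → ∀ l → l ∈ᶠ triple i j k → P l
  triple-elim P pi pj pk l l∈ with Sub.x∈p∪q⁻ ⁅ i ⁆ _ l∈
  ... | inj₁ q = ≡.subst P (≡.sym (Sub.x∈⁅y⁆⇒x≡y i q)) pi
  ... | inj₂ q with Sub.x∈p∪q⁻ ⁅ j ⁆ ⁅ k ⁆ q
  ...   | inj₁ q = ≡.subst P (≡.sym (Sub.x∈⁅y⁆⇒x≡y j q)) pj
  ...   | inj₂ q = ≡.subst P (≡.sym (Sub.x∈⁅y⁆⇒x≡y k q)) pk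

-- Ties on all sets are determined by the sets of size at most three on
-- which there are ties: if i and j are tied on J for f, they are tied for g
-- on {i, j}, and no k in J can have g k < g i = g j, as {i, j, k} is tied.
Tied-transfer : ∀ {n} {f g : Fin n → ℕ} → (∀ A → Nonempty A → Untied g A → Untied f A) →
  ∀ {J i} → Tied f J i → Tied g J i
Tied-transfer {f = f} {g} transfer {J} {i} ((i∈J , i-min) , j , (j∈J , j-min) , i≢j) =
  (i∈J , g-min) , j , (j∈J , λ k k∈J → ≡.subst (ℕ._≤ g k) gi≡gj (g-min k k∈J)) , i≢j
  where
  tied : ∀ k → k ∈ᶠ J → Tied f (triple i j k) i
  tied k k∈J = (triple₁ , triple-elim (λ l → f i ℕ.≤ f l) ℕ.≤-refl (i-min j j∈J) (i-min k k∈J)) ,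
    j , (triple₂ {i = i} , triple-elim (λ l → f j ℕ.≤ f l) (j-min i i∈J) ℕ.≤-refl (j-min k k∈J)) , i≢j

  not-strict : ∀ k → k ∈ᶠ J → ∀ {l} → l ∈ᶠ triple i j k →
    ¬ (∀ m → m ∈ᶠ triple i j k → m ≢ l → g l ℕ.< g m)
  not-strict k k∈J l∈ strict = transfer _ (i , triple₁ {j = j} {k}) (strictMin⇒Untied l∈ strict) i (tied k k∈J)

  gi≡gj : g i ≡ g j
  gi≡gj with ℕ.<-cmp (g i) (g j)
  -- With third member i the triple is just the pair {i, j}.
  ... | tri< lt _ _ = ⊥-elim (not-strict i i∈J triple₁
          (triple-elim (λ m → m ≢ i → g i ℕ.< g m) (λ ne → contradiction ≡.refl ne) (λ _ → lt)
            (λ ne → contradiction ≡.refl ne)))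
  ... | tri≈ _ e _ = e
  ... | tri> _ _ gt = ⊥-elim (not-strict i i∈J (triple₂ {i = i})
          (triple-elim (λ m → m ≢ j → g j ℕ.< g m) (λ _ → gt) (λ ne → contradiction ≡.refl ne) (λ _ → gt)))

  g-min : ∀ k → k ∈ᶠ J → g i ℕ.≤ g k
  g-min k k∈J = ℕ.≮⇒≥ λ gk<gi → not-strict k k∈J (triple₃ {i = i} {j})
    (triple-elim (λ m → m ≢ k → g k ℕ.< g m) (λ _ → gk<gi) (λ _ → ≡.subst (g k ℕ.<_) gi≡gj gk<gi)
      (λ ne → contradiction ≡.refl ne))

-- The preorder whose symmetric part is `∼`; going up removes ties.
_⊑_ : ∀ {n} → List (Subset n) → List (Subset n) → Set
π ⊑ τ = ∀ A → Nonempty A → ∣ A ↾ π ∣ ≡ 1 → ∣ A ↾ τ ∣ ≡ 1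

_⊑?_ : ∀ {n} (π τ : List (Subset n)) → Dec (π ⊑ τ)
π ⊑? τ = map′
  (λ all A → All.lookup all (allSubsets-complete A))
  (λ π⊑τ → All.tabulate λ {A} _ → π⊑τ A)
  (all? (λ A → nonempty? A →-dec ((∣ A ↾ π ∣ ℕ.≟ 1) →-dec (∣ A ↾ τ ∣ ℕ.≟ 1))) (allSubsets _))

∼-refl : ∀ {n} {π : List (Subset n)} → π ∼ π
∼-refl A _ = mk⇔ id id

∼-sym : ∀ {n} {π τ : List (Subset n)} → π ∼ τ → τ ∼ π
∼-sym p A A≢∅ = mk⇔ (from (p A A≢∅)) (to (p A A≢∅))

∼-trans : ∀ {n} {π τ ρ : List (Subset n)} → π ∼ τ → τ ∼ ρ → π ∼ ρ
∼-trans p q A A≢∅ = mk⇔ (to (q A A≢∅) ∘ to (p A A≢∅)) (from (p A A≢∅) ∘ from (q A A≢∅))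

∼⇒Tied⇔ : ∀ {n} {π τ : List (Subset n)} {f g} → Represents π f → Represents τ g → π ∼ τ →
  ∀ {J i} → Tied f J i ⇔ Tied g J i
∼⇒Tied⇔ {π = π} {τ} r s π∼τ = mk⇔
  (Tied-transfer λ A A≢∅ → to (∣↾∣≡1⇔Untied {π = π} r A≢∅) ∘ from (π∼τ A A≢∅) ∘ from (∣↾∣≡1⇔Untied {π = τ} s A≢∅))
  (Tied-transfer λ A A≢∅ → to (∣↾∣≡1⇔Untied {π = τ} s A≢∅) ∘ to (π∼τ A A≢∅) ∘ from (∣↾∣≡1⇔Untied {π = π} r A≢∅))

multi? : ∀ {n} (π : List (Subset n)) → Decidable (λ A → Nonempty A × ∣ A ↾ π ∣ ≢ 1)
multi? π A = nonempty? A ×-dec ¬? (∣ A ↾ π ∣ ℕ.≟ 1)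

corank : ∀ {n} → List (Subset n) → ℕ
corank {n} π = length (filter (multi? π) (allSubsets n))

length-filter-mono : ∀ {A : Set} {P Q : Pred A 0ℓ} (P? : Decidable P) (Q? : Decidable Q) →
  (∀ {x} → P x → Q x) → ∀ xs → length (filter P? xs) ℕ.≤ length (filter Q? xs)
length-filter-mono P? Q? P⊆Q []       = z≤n
length-filter-mono P? Q? P⊆Q (x ∷ xs) with P? x | Q? x
... | yes p | yes q = s≤s (length-filter-mono P? Q? P⊆Q xs)
... | yes p | no ¬q = contradiction (P⊆Q p) ¬q
... | no ¬p | yes q = ℕ.m≤n⇒m≤1+n (length-filter-mono P? Q? P⊆Q xs)
... | no ¬p | no ¬q = length-filter-mono P? Q? P⊆Q xs

length-filter-strict : ∀ {A : Set} {P Q : Pred A 0ℓ} (P? : Decidable P) (Q? : Decidable Q) →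
  (∀ {x} → P x → Q x) → ∀ {xs} → Any (λ x → Q x × ¬ P x) xs →
  length (filter P? xs) ℕ.< length (filter Q? xs)
length-filter-strict P? Q? P⊆Q {x ∷ xs} (here (q , ¬p)) with P? x | Q? x
... | yes p | _     = contradiction p ¬p
... | no _  | yes _ = s≤s (length-filter-mono P? Q? P⊆Q xs)
... | no _  | no ¬q = contradiction q ¬q
length-filter-strict P? Q? P⊆Q {x ∷ xs} (there any) with P? x | Q? x
... | yes p | yes q = s≤s (length-filter-strict P? Q? P⊆Q any)
... | yes p | no ¬q = contradiction (P⊆Q p) ¬q
... | no ¬p | yes q = ℕ.m≤n⇒m≤1+n (length-filter-strict P? Q? P⊆Q any)
... | no ¬p | no ¬q = length-filter-strict P? Q? P⊆Q any

-- A set on which τ is untied but π is tied exists because τ ⋢ π can be checked by a search over the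
-- finitely many subsets. It is counted for π only.
corank-< : ∀ {n} {π τ : List (Subset n)} → π ⊑ τ → ¬ τ ⊑ π → corank τ ℕ.< corank π
corank-< {n} {π} {τ} π⊑τ τ⋢π = length-filter-strict (multi? τ) (multi? π)
  (λ (A≢∅ , ne) → A≢∅ , λ e → ne (π⊑τ _ A≢∅ e))
  (decidable-stable (Any.any? (λ A → multi? π A ×-dec ¬? (multi? τ A)) (allSubsets n)) λ none →
    τ⋢π λ A A≢∅ e → decidable-stable (∣ A ↾ π ∣ ℕ.≟ 1) λ ne →
      none (List.lose (allSubsets-complete A) ((A≢∅ , ne) , λ (_ , ne′) → ne′ e)))

-- Faces of Minkowski sums of simplices

module _ (ℝ : Reals) where

  open Reals ℝ hiding (zero)
  open CommutativeRing commutativeRing using (+-commutativeMonoid; +-commutativeSemigroup)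
  open Multiples semiring using (×-comm-*)
  open CommutativeMultiples +-commutativeMonoid using (×-distrib-+)
  open CommutativeSemigroupProperties +-commutativeSemigroup using (interchange)
  open RingProperties ring using (+-cancelˡ)
  open SetoidReasoning setoid

  ≤-resp : ∀ {x x′ y y′} → x ≈ x′ → y ≈ y′ → x ≤ y → x′ ≤ y′
  ≤-resp p q x≤y = ≤-trans (≤-reflexive (sym p)) (≤-trans x≤y (≤-reflexive q))

  +-cancelʳ-≤ : ∀ {x y} z → x + z ≤ y + z → x ≤ y
  +-cancelʳ-≤ z p = ≤-resp (add-sub _) (add-sub _) (+-monoˡ-≤ (- z) p)
    where
    add-sub : ∀ x → x + z - z ≈ x
    add-sub x = trans (+-assoc x z (- z)) (trans (+-congˡ (-‿inverseʳ z)) (+-identityʳ x))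

  +-cancelˡ-≤ : ∀ {x y} z → z + x ≤ z + y → x ≤ y
  +-cancelˡ-≤ z p = +-cancelʳ-≤ z (≤-resp (+-comm z _) (+-comm z _) p)

  ×-nonNegative : ∀ n {y} → 0# ≤ y → 0# ≤ n ×ℕ y
  ×-nonNegative zero    _ = ≤-refl
  ×-nonNegative (suc n) p = ≤-resp (+-identityˡ 0#) refl (+-mono-≤ ℝ p (×-nonNegative n p))

  ×-monoˡ-≤ : ∀ {m n y} → 0# ≤ y → m ℕ.≤ n → m ×ℕ y ≤ n ×ℕ y
  ×-monoˡ-≤ {n = n} p z≤n = ×-nonNegative n p
  ×-monoˡ-≤ p (s≤s m≤n) = +-mono-≤ ℝ ≤-refl (×-monoˡ-≤ p m≤n)

  -- From m + 1 ≤ n follows y + m y ≤ n y = m y, hence y ≤ 0.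
  ×-cancel : ∀ {m n y} → 0# ≤ y → m ℕ.< n → n ×ℕ y ≈ m ×ℕ y → y ≈ 0#
  ×-cancel {m} {n} {y} p m<n e = antisym
    (+-cancelʳ-≤ (m ×ℕ y) (≤-resp refl (trans e (sym (+-identityˡ _))) (×-monoˡ-≤ p m<n))) p

  ×≈×1* : ∀ n y → n ×ℕ y ≈ (n ×ℕ 1#) * y
  ×≈×1* n y = sym (trans (×-assoc-* n 1# y) (×-congʳ n (*-identityˡ y)))

  sum-× : ∀ {n} m (x : Vector Carrier n) → sum (λ k → m ×ℕ x k) ≈ m ×ℕ sum x
  sum-× m x = begin
    sum (λ k → m ×ℕ x k)         ≈⟨ sum-cong-≋ (λ k → ×≈×1* m (x k)) ⟩
    sum (λ k → (m ×ℕ 1#) * x k)  ≈⟨ *-distribˡ-sum (m ×ℕ 1#) x ⟨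
    (m ×ℕ 1#) * sum x            ≈⟨ ×≈×1* m (sum x) ⟨
    m ×ℕ sum x                   ∎

  sum-mono : ∀ {n} {f g : Vector Carrier n} → (∀ k → f k ≤ g k) → sum f ≤ sum g
  sum-mono {zero}  _ = ≤-refl
  sum-mono {suc n} p = +-mono-≤ ℝ (p zero) (sum-mono (p ∘ suc))

  sum-squeeze : ∀ {n} {f g : Vector Carrier n} → (∀ k → f k ≤ g k) → sum g ≤ sum f → ∀ k → g k ≈ f k
  sum-squeeze {suc n} {f} {g} p s zero = antisym
    (+-cancelʳ-≤ (sum (f ∘ suc)) (≤-trans (+-mono-≤ ℝ ≤-refl (sum-mono (p ∘ suc))) s)) (p zero)
  sum-squeeze {suc n} {f} {g} p s (suc k) = sum-squeeze (p ∘ suc)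
    (+-cancelˡ-≤ (f zero) (≤-trans (+-mono-≤ ℝ (p zero) ≤-refl) s)) k

  basis-same : ∀ {n} (i : Fin n) → basis ℝ i i ≈ 1#
  basis-same i rewrite dec-true (i Fin.≟ i) ≡.refl = refl

  basis-other : ∀ {n} {i j : Fin n} → i ≢ j → basis ℝ j i ≈ 0#
  basis-other {i = i} {j} i≢j rewrite dec-false (i Fin.≟ j) i≢j = refl

  sum-single : ∀ {n} (x : Point ℝ n) i → (∀ k → k ≢ i → x k ≈ 0#) → sum x ≈ x i
  sum-single x i p = trans (sum-cong-≋ term) (sum-indicator ℝ x i)
    where
    term : ∀ k → x k ≈ basis ℝ i k * x k
    term k with k Fin.≟ i
    ... | yes ≡.refl = sym (*-identityˡ (x k))
    ... | no  k≢i    = trans (p k k≢i) (sym (zeroˡ (x k)))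

  coordinate≤sum : ∀ {n} (x : Point ℝ n) → (∀ k → 0# ≤ x k) → ∀ i → x i ≤ sum x
  coordinate≤sum x p i = ≤-resp (sum-indicator ℝ x i) refl (sum-mono term)
    where
    term : ∀ k → basis ℝ i k * x k ≤ x k
    term k with k Fin.≟ i
    ... | yes ≡.refl = ≤-reflexive (*-identityˡ (x k))
    ... | no  k≢i    = ≤-resp (sym (zeroˡ (x k))) refl (p k)

  -- Minimal faces and coordinate ranges

  _⊞_ : ∀ {n} → Point ℝ n → Point ℝ n → Point ℝ n
  (x ⊞ y) i = x i + y i

  functional-⊞ : ∀ {n} (w : Vec ℕ n) x y {z} → _≋_ ℝ z (x ⊞ y) →
    functional ℝ w z ≈ functional ℝ w x + functional ℝ w y
  functional-⊞ w x y e = trans (functional-cong ℝ w e)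
    (trans (sum-cong-≋ λ i → ×-distrib-+ (x i) (y i) (suc (Vec.lookup w i)))
      (∑-distrib-+ (λ i → suc (Vec.lookup w i) ×ℕ x i) (λ i → suc (Vec.lookup w i) ×ℕ y i)))

  minimalFace-≐ : ∀ {n} {Q R : Pred (Point ℝ n) 0ℓ} w → Q ≐ R → minimalFace ℝ Q w ≐ minimalFace ℝ R w
  minimalFace-≐ w (Q⊆R , R⊆Q) =
    (λ (x∈ , min) → Q⊆R x∈ , λ y y∈ → min y (R⊆Q y∈)) ,
    (λ (x∈ , min) → R⊆Q x∈ , λ y y∈ → min y (Q⊆R y∈))

  -- The functional is additive, so a sum y + z is minimal iff both summands are: vary one summand
  -- while the other stays fixed, and cancel.
  minimalFace-⊕ : ∀ {n} (Q R : Pred (Point ℝ n) 0ℓ) w →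
    minimalFace ℝ (_⊕_ ℝ Q R) w ≐ _⊕_ ℝ (minimalFace ℝ Q w) (minimalFace ℝ R w)
  minimalFace-⊕ Q R w =
    (λ {x} ((y , z , y∈ , z∈ , e) , min) → y , z ,
      (y∈ , λ y′ y′∈ → +-cancelʳ-≤ _ (≤-resp (functional-⊞ w y z e) (functional-⊞ w y′ z λ _ → refl)
        (min (y′ ⊞ z) (y′ , z , y′∈ , z∈ , λ _ → refl)))) ,
      (z∈ , λ z′ z′∈ → +-cancelˡ-≤ _ (≤-resp (functional-⊞ w y z e) (functional-⊞ w y z′ λ _ → refl)
        (min (y ⊞ z′) (y , z′ , y∈ , z′∈ , λ _ → refl)))) , e) ,
    (λ {x} (y , z , (y∈ , y-min) , (z∈ , z-min) , e) → (y , z , y∈ , z∈ , e) ,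
      λ x′ (y′ , z′ , y′∈ , z′∈ , e′) →
        ≤-resp (sym (functional-⊞ w y z e)) (sym (functional-⊞ w y′ z′ e′))
          (+-mono-≤ ℝ (y-min y′ y′∈) (z-min z′ z′∈)))

  -- Requiring the endpoints to be attained makes them unique and additive under Minkowski sums by
  -- direct comparison of points.
  record Range {n} (Q : Pred (Point ℝ n) 0ℓ) (i : Fin n) (lo hi : Carrier) : Set where
    field
      attains-lo : ∃ λ x → x ∈ Q × x i ≈ lo
      attains-hi : ∃ λ x → x ∈ Q × x i ≈ hi
      lo≤        : ∀ x → x ∈ Q → lo ≤ x i
      ≤hi        : ∀ x → x ∈ Q → x i ≤ hi

  open Range

  Range-≈ : ∀ {n} {Q : Pred (Point ℝ n) 0ℓ} {i lo hi lo′ hi′} → lo ≈ lo′ → hi ≈ hi′ →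
    Range Q i lo hi → Range Q i lo′ hi′
  Range-≈ e e′ r = record
    { attains-lo = map₂ (map₂ λ p → trans p e) (attains-lo r)
    ; attains-hi = map₂ (map₂ λ p → trans p e′) (attains-hi r)
    ; lo≤ = λ x x∈ → ≤-resp e refl (lo≤ r x x∈)
    ; ≤hi = λ x x∈ → ≤-resp refl e′ (≤hi r x x∈)
    }

  Range-≐ : ∀ {n} {Q R : Pred (Point ℝ n) 0ℓ} {i lo hi} → Q ≐ R → Range Q i lo hi → Range R i lo hi
  Range-≐ (Q⊆R , R⊆Q) r = record
    { attains-lo = map₂ (λ (x∈ , e) → Q⊆R x∈ , e) (attains-lo r)
    ; attains-hi = map₂ (λ (x∈ , e) → Q⊆R x∈ , e) (attains-hi r)
    ; lo≤ = λ x x∈ → lo≤ r x (R⊆Q x∈)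
    ; ≤hi = λ x x∈ → ≤hi r x (R⊆Q x∈)
    }

  Range-unique : ∀ {n} {Q : Pred (Point ℝ n) 0ℓ} {i lo hi lo′ hi′} →
    Range Q i lo hi → Range Q i lo′ hi′ → lo ≈ lo′ × hi ≈ hi′
  Range-unique r s = antisym (below r s) (below s r) , antisym (above r s) (above s r)
    where
    below : ∀ {n} {Q : Pred (Point ℝ n) 0ℓ} {i lo hi lo′ hi′} →
      Range Q i lo hi → Range Q i lo′ hi′ → lo ≤ lo′
    below r s = let (x , x∈ , e) = attains-lo s in ≤-resp refl e (lo≤ r x x∈)
    above : ∀ {n} {Q : Pred (Point ℝ n) 0ℓ} {i lo hi lo′ hi′} →
      Range Q i lo hi → Range Q i lo′ hi′ → hi ≤ hi′
    above r s = let (x , x∈ , e) = attains-hi r in ≤-resp e refl (≤hi s x x∈)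

  Range-⊕ : ∀ {n} {Q R : Pred (Point ℝ n) 0ℓ} {i lo hi lo′ hi′} →
    Range Q i lo hi → Range R i lo′ hi′ → Range (_⊕_ ℝ Q R) i (lo + lo′) (hi + hi′)
  Range-⊕ {i = i} r s = record
    { attains-lo = let (x , x∈ , e) = attains-lo r ; (y , y∈ , e′) = attains-lo s in
        x ⊞ y , (x , y , x∈ , y∈ , λ _ → refl) , +-cong e e′
    ; attains-hi = let (x , x∈ , e) = attains-hi r ; (y , y∈ , e′) = attains-hi s in
        x ⊞ y , (x , y , x∈ , y∈ , λ _ → refl) , +-cong e e′
    ; lo≤ = λ z (x , y , x∈ , y∈ , e) → ≤-resp refl (sym (e i)) (+-mono-≤ ℝ (lo≤ r x x∈) (lo≤ s y y∈))
    ; ≤hi = λ z (x , y , x∈ , y∈ , e) → ≤-resp (sym (e i)) refl (+-mono-≤ ℝ (≤hi r x x∈) (≤hi s y y∈))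
    }

  Range-point : ∀ {n} {Q : Pred (Point ℝ n) 0ℓ} {p} → Q ≐ (λ x → _≋_ ℝ x p) → ∀ i → Range Q i (p i) (p i)
  Range-point {p = p} (⊆ , ⊇) i = record
    { attains-lo = p , ⊇ (λ _ → refl) , refl
    ; attains-hi = p , ⊇ (λ _ → refl) , refl
    ; lo≤ = λ x x∈ → ≤-reflexive (sym (⊆ x∈ i))
    ; ≤hi = λ x x∈ → ≤-reflexive (⊆ x∈ i)
    }

  -- Convex hulls and their Minkowski sums

  conv-≋ : ∀ {n} (V : List (Point ℝ n)) {x y} → _≋_ ℝ y x → x ∈ conv ℝ V → y ∈ conv ℝ V
  conv-≋ V e (t , p , s , e′) = t , p , s , λ i → trans (e i) (e′ i)

  ∈conv : ∀ {n} {V : List (Point ℝ n)} {v} → v List.∈ V → v ∈ conv ℝ V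
  ∈conv {V = V} v∈V = ≡.subst (_∈ conv ℝ V) (≡.sym (Any.lookup-index v∈V)) (lookup∈conv ℝ V (Any.index v∈V))

  -- Closure is required under all finite convex combinations, not just along segments, to match the
  -- shape of `conv`; `conv-⊆` is then immediate.
  Convex : ∀ {n} → Pred (Point ℝ n) 0ℓ → Set
  Convex {n} C = ∀ {m} (t : Vector Carrier m) (p : Fin m → Point ℝ n) →
    (∀ k → 0# ≤ t k) → sum t ≈ 1# → (∀ k → p k ∈ C) →
    ∀ x → _≋_ ℝ x (λ i → sum (λ k → t k * p k i)) → x ∈ C

  conv-⊆ : ∀ {n} {V : List (Point ℝ n)} {C} → Convex C → All C V → ∀ {x} → x ∈ conv ℝ V → x ∈ C
  conv-⊆ {V = V} convex all {x} (t , p , s , e) =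
    convex t (lookup V) p s (λ k → All.lookup all (List.∈-lookup k)) x e

  conv-convex : ∀ {n} (V : List (Point ℝ n)) → Convex (conv ℝ V)
  conv-convex V t p t≥0 Σt≈1 p∈ x e =
    (λ l → sum (λ k → t k * s k l)) ,
    (λ l → sum-nonNegative ℝ _ (λ k → *-nonNegative (t≥0 k) (proj₁ (proj₂ (p∈ k)) l))) ,
    (begin
      sum (λ l → sum (λ k → t k * s k l))  ≈⟨ ∑-comm (λ l k → t k * s k l) ⟩
      sum (λ k → sum (λ l → t k * s k l))  ≈⟨ sum-cong-≋ (λ k → *-distribˡ-sum (t k) (s k)) ⟨
      sum (λ k → t k * sum (s k))          ≈⟨ sum-cong-≋ (λ k → trans (*-congˡ (proj₁ (proj₂ (proj₂ (p∈ k))))) (*-identityʳ (t k))) ⟩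
      sum t                                ≈⟨ Σt≈1 ⟩
      1#                                   ∎) ,
    λ i → begin
      x i                                        ≈⟨ e i ⟩
      sum (λ k → t k * p k i)                    ≈⟨ sum-cong-≋ (λ k → *-congˡ (proj₂ (proj₂ (proj₂ (p∈ k))) i)) ⟩
      sum (λ k → t k * sum (λ l → s k l * v l i)) ≈⟨ sum-cong-≋ (λ k → *-distribˡ-sum (t k) (λ l → s k l * v l i)) ⟩
      sum (λ k → sum (λ l → t k * (s k l * v l i))) ≈⟨ ∑-comm (λ k l → t k * (s k l * v l i)) ⟩
      sum (λ l → sum (λ k → t k * (s k l * v l i))) ≈⟨ sum-cong-≋ (λ l → sum-cong-≋ (λ k → *-assoc (t k) (s k l) (v l i))) ⟨
      sum (λ l → sum (λ k → t k * s k l * v l i)) ≈⟨ sum-cong-≋ (λ l → *-distribʳ-sum (v l i) (λ k → t k * s k l)) ⟨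
      sum (λ l → sum (λ k → t k * s k l) * v l i) ∎
    where
    v = lookup V
    s : ∀ k → Vector Carrier (length V)
    s k = proj₁ (p∈ k)

  ⊕-convex : ∀ {n} {Q R : Pred (Point ℝ n) 0ℓ} → Convex Q → Convex R → Convex (_⊕_ ℝ Q R)
  ⊕-convex Q-convex R-convex t p t≥0 Σt≈1 p∈ x e =
    _ , _ ,
    Q-convex t q t≥0 Σt≈1 (λ k → proj₁ (proj₂ (proj₂ (p∈ k)))) _ (λ _ → refl) ,
    R-convex t r t≥0 Σt≈1 (λ k → proj₁ (proj₂ (proj₂ (proj₂ (p∈ k))))) _ (λ _ → refl) ,
    λ i → begin
      x i                              ≈⟨ e i ⟩
      sum (λ k → t k * p k i)          ≈⟨ sum-cong-≋ (λ k → trans (*-congˡ (proj₂ (proj₂ (proj₂ (proj₂ (p∈ k)))) i)) (distribˡ (t k) _ _)) ⟩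
      sum (λ k → t k * q k i + t k * r k i) ≈⟨ ∑-distrib-+ (λ k → t k * q k i) (λ k → t k * r k i) ⟩
      sum (λ k → t k * q k i) + sum (λ k → t k * r k i) ∎
    where
    q = λ k → proj₁ (p∈ k)
    r = λ k → proj₁ (proj₂ (p∈ k))

  -- The weights sum to 1, so a is the same convex combination of copies of itself. The quantified
  -- `z` absorbs the pointwise equality of points.
  translate-convex : ∀ {n} {C : Pred (Point ℝ n) 0ℓ} → Convex C → ∀ a →
    Convex (λ x → ∀ z → _≋_ ℝ z (x ⊞ a) → z ∈ C)
  translate-convex C-convex a t p t≥0 Σt≈1 p∈ x e z e′ =
    C-convex t (λ k → p k ⊞ a) t≥0 Σt≈1 (λ k → p∈ k _ (λ _ → refl)) z λ i → begin
      z i                                        ≈⟨ e′ i ⟩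
      x i + a i                                  ≈⟨ +-cong (e i) (trans (sym (*-identityˡ (a i))) (*-congʳ (sym Σt≈1))) ⟩
      sum (λ k → t k * p k i) + sum t * a i      ≈⟨ +-congˡ (*-distribʳ-sum (a i) t) ⟩
      sum (λ k → t k * p k i) + sum (λ k → t k * a i) ≈⟨ ∑-distrib-+ (λ k → t k * p k i) (λ k → t k * a i) ⟨
      sum (λ k → t k * p k i + t k * a i)        ≈⟨ sum-cong-≋ (λ k → distribˡ (t k) (p k i) (a i)) ⟨
      sum (λ k → t k * (p k i + a i))            ∎

  _⊞ˡ_ : ∀ {n} → List (Point ℝ n) → List (Point ℝ n) → List (Point ℝ n)
  _⊞ˡ_ = cartesianProductWith _⊞_

  -- The forward inclusion avoids products of weights. For fixed x, the y with x + y in the hull on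
  -- the right form a convex set, so it suffices to take y in W; for such y the same argument
  -- reduces x to V.
  conv-⊕ : ∀ {n} (V W : List (Point ℝ n)) → _⊕_ ℝ (conv ℝ V) (conv ℝ W) ≐ conv ℝ (V ⊞ˡ W)
  conv-⊕ V W =
    (λ {z} (x , y , x∈ , y∈ , e) →
      conv-⊆ {V = W} (translate-convex C-convex x) (All.tabulate λ {w} w∈ z e →
        conv-⊆ {V = V} (translate-convex C-convex w) (All.tabulate λ {v} v∈ z e →
          conv-≋ (V ⊞ˡ W) e (∈conv (List.∈-cartesianProductWith⁺ _⊞_ v∈ w∈)))
          x∈ z (λ i → trans (e i) (+-comm _ _)))
        y∈ z (λ i → trans (e i) (+-comm _ _))) ,
    conv-⊆ {V = V ⊞ˡ W} (⊕-convex (conv-convex V) (conv-convex W)) (All.tabulate λ p →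
      case List.∈-cartesianProductWith⁻ _⊞_ V W p of λ { (v , w , v∈ , w∈ , ≡.refl) →
        v , w , ∈conv v∈ , ∈conv w∈ , λ _ → refl })
    where
    C-convex = conv-convex (V ⊞ˡ W)

  conv-singleton : ∀ {n} (v : Point ℝ n) → conv ℝ (v ∷ []) ≐ (λ x → _≋_ ℝ x v)
  conv-singleton v =
    (λ (t , _ , s , e) i → trans (e i) (trans (+-identityʳ _) (trans (*-congʳ (trans (sym (+-identityʳ _)) s)) (*-identityˡ (v i))))) ,
    (λ e → conv-≋ (v ∷ []) e (∈conv {V = v ∷ []} (here ≡.refl)))

  -- Faces of a dilated simplex

  width : ∀ {n} → Vec ℕ n → Subset n → Fin n → Carrier
  width w J i = if does (Tied? (Vec.lookup w) J i) then 1# else 0#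

  width-Tied : ∀ {n} {w : Vec ℕ n} {J i} → Tied (Vec.lookup w) J i → width w J i ≈ 1#
  width-Tied {w = w} {J} {i} tied =
    reflexive (≡.cong (if_then 1# else 0#) (dec-true (Tied? (Vec.lookup w) J i) tied))

  width-¬Tied : ∀ {n} {w : Vec ℕ n} {J i} → ¬ Tied (Vec.lookup w) J i → width w J i ≈ 0#
  width-¬Tied {w = w} {J} {i} ¬tied =
    reflexive (≡.cong (if_then 1# else 0#) (dec-false (Tied? (Vec.lookup w) J i) ¬tied))

  totalWidth : ∀ {n} → Vec ℕ n → (Subset n → Carrier) → List (Subset n) → Fin n → Carrier
  totalWidth w b Js i = foldr (λ J s → b J * width w J i + s) 0# Js

  scaledBasis : ∀ {n} → Carrier → Fin n → Point ℝ n
  scaledBasis b i k = b * basis ℝ i k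

  scaledBasis∈ : ∀ {n} {J : Subset n} {i} b → i ∈ᶠ J → scaledBasis b i ∈ dilate ℝ b (simplex ℝ J)
  scaledBasis∈ {J = J} {i} b i∈J = basis ℝ i ,
    ∈conv (List.∈-map⁺ (basis ℝ) (List.∈-filter⁺ (_∈? J) (List.∈-allFin i) i∈J)) , λ _ → refl

  functional-scaledBasis : ∀ {n} (w : Vec ℕ n) b i →
    functional ℝ w (scaledBasis b i) ≈ suc (Vec.lookup w i) ×ℕ b
  functional-scaledBasis w b i = begin
    sum (λ k → suc (Vec.lookup w k) ×ℕ (b * basis ℝ i k))
      ≈⟨ sum-cong-≋ (λ k → ×-congʳ (suc (Vec.lookup w k)) (*-comm b _)) ⟩
    sum (λ k → suc (Vec.lookup w k) ×ℕ (basis ℝ i k * b))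
      ≈⟨ sum-cong-≋ (λ k → sym (×-comm-* (suc (Vec.lookup w k)) (basis ℝ i k) b)) ⟩
    sum (λ k → basis ℝ i k * (suc (Vec.lookup w k) ×ℕ b))
      ≈⟨ sum-indicator ℝ (λ k → suc (Vec.lookup w k) ×ℕ b) i ⟩
    suc (Vec.lookup w i) ×ℕ b ∎

  -- The inequality description of the simplex dilated by b ≥ 0. It bounds coordinates from outside,
  -- while the scaled basis vectors supply points inside.
  record InSimplex {n} (b : Carrier) (J : Subset n) (x : Point ℝ n) : Set where
    constructor inSimplex
    field
      nonNegative : ∀ k → 0# ≤ x k
      total-mass  : sum x ≈ b
      supported   : ∀ k → ¬ k ∈ᶠ J → x k ≈ 0#

  open InSimplex

  InSimplex-convex : ∀ {n} b (J : Subset n) → Convex (InSimplex b J)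
  InSimplex-convex b J {m} t p t≥0 Σt≈1 p∈ x e = inSimplex
    (λ i → ≤-resp refl (sym (e i)) (sum-nonNegative ℝ _ λ k → *-nonNegative (t≥0 k) (nonNegative (p∈ k) i)))
    (begin
      sum x                                ≈⟨ sum-cong-≋ e ⟩
      sum (λ i → sum (λ k → t k * p k i))  ≈⟨ ∑-comm (λ i k → t k * p k i) ⟩
      sum (λ k → sum (λ i → t k * p k i))  ≈⟨ sum-cong-≋ (λ k → trans (sym (*-distribˡ-sum (t k) (p k))) (*-congˡ (total-mass (p∈ k)))) ⟩
      sum (λ k → t k * b)                  ≈⟨ *-distribʳ-sum b t ⟨
      sum t * b                            ≈⟨ trans (*-congʳ Σt≈1) (*-identityˡ b) ⟩
      b                                    ∎)
    (λ i i∉J → trans (e i) (trans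
      (sum-cong-≋ λ k → trans (*-congˡ (supported (p∈ k) i i∉J)) (zeroʳ (t k))) (sum-replicate-zero m)))

  ∈simplex⇒InSimplex : ∀ {n} {J : Subset n} {x} → x ∈ simplex ℝ J → InSimplex 1# J x
  ∈simplex⇒InSimplex {J = J} = conv-⊆ (InSimplex-convex 1# J) (All.map⁺ (All.tabulate λ {i} i∈ →
    inSimplex (basis-nonNegative ℝ i) (sum-basis ℝ i) λ k k∉J → basis-other λ k≡i →
      k∉J (≡.subst (_∈ᶠ J) (≡.sym k≡i) (proj₂ (List.∈-filter⁻ (_∈? J) {xs = allFin _} i∈)))))

  ∈dilate⇒InSimplex : ∀ {n} {J : Subset n} {b x} → 0# ≤ b → x ∈ dilate ℝ b (simplex ℝ J) → InSimplex b J x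
  ∈dilate⇒InSimplex {b = b} b≥0 (y , y∈ , e) = inSimplex
    (λ k → ≤-resp refl (sym (e k)) (*-nonNegative b≥0 (nonNegative y∈′ k)))
    (trans (sum-cong-≋ e) (trans (sym (*-distribˡ-sum b y)) (trans (*-congˡ (total-mass y∈′)) (*-identityʳ b))))
    (λ k k∉J → trans (e k) (trans (*-congˡ (supported y∈′ k k∉J)) (zeroʳ b)))
    where
    y∈′ = ∈simplex⇒InSimplex y∈

  module _ {n} (w : Vec ℕ n) {J : Subset n} (J≢∅ : Nonempty J) {b : Carrier} (b≥0 : 0# ≤ b) where

    private
      f = Vec.lookup w
      Δ = dilate ℝ b (simplex ℝ J)
      m = proj₁ (minimizer f J≢∅)
      m-min = proj₂ (minimizer f J≢∅)

    -- Each weight is lowered to the smallest weight on J; off J both sides vanish. Summing turns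
    -- the left side into the constant (f m + 1) b, the minimum of the functional.
    min-term≤ : ∀ {x} → InSimplex b J x → ∀ k → suc (f m) ×ℕ x k ≤ suc (f k) ×ℕ x k
    min-term≤ x∈ k with k ∈? J
    ... | yes k∈J = ×-monoˡ-≤ (nonNegative x∈ k) (s≤s (proj₂ m-min k k∈J))
    ... | no  k∉J = ≤-reflexive (trans (zero′ (suc (f m))) (sym (zero′ (suc (f k)))))
      where
      zero′ : ∀ n → n ×ℕ _ ≈ 0#
      zero′ n = trans (×-congʳ n (supported x∈ k k∉J)) (trans (×≈×1* n 0#) (zeroʳ _))

    sum-min-term : ∀ {x} → InSimplex b J x → sum (λ k → suc (f m) ×ℕ x k) ≈ suc (f m) ×ℕ b
    sum-min-term {x} x∈ = trans (sum-× (suc (f m)) x) (×-congʳ (suc (f m)) (total-mass x∈))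

    scaledBasis∈face : ∀ {i} → Min f J i → scaledBasis b i ∈ minimalFace ℝ Δ w
    scaledBasis∈face {i} (i∈J , i-min) = scaledBasis∈ b i∈J , λ y y∈ →
      let y∈′ = ∈dilate⇒InSimplex b≥0 y∈ in
      ≤-resp
        (trans (sum-min-term y∈′) (trans
          (reflexive (≡.cong (λ k → suc k ×ℕ b) (ℕ.≤-antisym (proj₂ m-min i i∈J) (i-min m (proj₁ m-min)))))
          (sym (functional-scaledBasis w b i))))
        refl (sum-mono (min-term≤ y∈′))

    -- At a minimal point the termwise inequalities sum to an equality, so each is an equality: (f m
    -- + 1) x_k = (f k + 1) x_k. If f m < f k, this forces x_k = 0.
    face-support : ∀ {x} → x ∈ minimalFace ℝ Δ w → ∀ k → ¬ Min f J k → x k ≈ 0#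
    face-support {x} (x∈ , min) k ¬min with k ∈? J
    ... | no  k∉J = supported (∈dilate⇒InSimplex b≥0 x∈) k k∉J
    ... | yes k∈J = ×-cancel (nonNegative x∈′ k) (s≤s fm<fk)
        (sum-squeeze (min-term≤ x∈′)
          (≤-resp refl (trans (functional-scaledBasis w b m) (sym (sum-min-term x∈′)))
            (min _ (scaledBasis∈ b (proj₁ m-min)))) k)
      where
      x∈′ = ∈dilate⇒InSimplex b≥0 x∈
      fm<fk : f m ℕ.< f k
      fm<fk = ℕ.≰⇒> λ fk≤fm → ¬min (k∈J , λ j j∈J → ℕ.≤-trans fk≤fm (proj₂ m-min j j∈J))

    scaledBasis-same : ∀ (i : Fin n) → scaledBasis b i i ≈ b
    scaledBasis-same i = trans (*-congˡ (basis-same i)) (*-identityʳ b)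

    scaledBasis-other : ∀ {i j : Fin n} → i ≢ j → scaledBasis b j i ≈ 0#
    scaledBasis-other i≢j = trans (*-congˡ (basis-other i≢j)) (zeroʳ b)

    -- If f is tied at i, the value 0 is attained at the other minimizer and b at i itself.
    -- Otherwise the coordinate is constant: it is 0 if i is no minimizer, and b if i is the only
    -- one and hence carries all the mass.
    face-Range : ∀ i → ∃ λ lo → Range (minimalFace ℝ Δ w) i lo (lo + b * width w J i)
    face-Range i with Tied? f J i
    ... | yes tied@(i-min , j , j-min , i≢j) = 0# ,
        Range-≈ refl (sym (trans (+-identityˡ _) (trans (*-congˡ (width-Tied {w = w} tied)) (*-identityʳ b)))) record
          { attains-lo = _ , scaledBasis∈face j-min , scaledBasis-other i≢j
          ; attains-hi = _ , scaledBasis∈face i-min , scaledBasis-same i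
          ; lo≤ = λ x (x∈ , _) → nonNegative (∈dilate⇒InSimplex b≥0 x∈) i
          ; ≤hi = λ x (x∈ , _) → let x∈′ = ∈dilate⇒InSimplex b≥0 x∈ in
              ≤-resp refl (total-mass x∈′) (coordinate≤sum x (nonNegative x∈′) i)
          }
    ... | no untied = c , Range-≈ refl (sym (trans (+-congˡ (trans (*-congˡ (width-¬Tied {w = w} untied)) (zeroʳ b))) (+-identityʳ c))) record
          { attains-lo = _ , scaledBasis∈face m-min , const _ (scaledBasis∈face m-min)
          ; attains-hi = _ , scaledBasis∈face m-min , const _ (scaledBasis∈face m-min)
          ; lo≤ = λ x x∈ → ≤-reflexive (sym (const x x∈))
          ; ≤hi = λ x x∈ → ≤-reflexive (const x x∈)
          }
      where
      constant : ∃ λ c → ∀ x → x ∈ minimalFace ℝ Δ w → x i ≈ c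
      constant with Min? f J i
      ... | no ¬min = 0# , λ x x∈ → face-support x∈ i ¬min
      ... | yes i-min = b , λ x x∈ → trans
            (sym (sum-single x i λ k k≢i → face-support x∈ k λ k-min →
              untied (i-min , k , k-min , k≢i ∘ ≡.sym)))
            (total-mass (∈dilate⇒InSimplex b≥0 (proj₁ x∈)))
      c = proj₁ constant
      const = proj₂ constant

  -- Non-emptiness is recorded separately, since for n = 0 there is no coordinate whose range could
  -- supply a point.
  Ranges : ∀ {n} → Pred (Point ℝ n) 0ℓ → (Fin n → Carrier) → Set
  Ranges Q d = ∃ Q × ∀ i → ∃ λ lo → Range Q i lo (lo + d i)

  minkowskiSum-Ranges : ∀ {n} (w : Vec ℕ n) (b : Subset n → Carrier) Js →
    All (λ J → Nonempty J × 0# ≤ b J) Js →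
    Ranges (minimalFace ℝ (minkowskiSum ℝ (map (λ J → dilate ℝ (b J) (simplex ℝ J)) Js)) w)
      (totalWidth w b Js)
  minkowskiSum-Ranges w b [] [] = (origin ℝ , 0∈face) , λ i → 0# , record
      { attains-lo = origin ℝ , 0∈face , refl
      ; attains-hi = origin ℝ , 0∈face , sym (+-identityʳ 0#)
      ; lo≤ = λ x (x∈ , _) → ≤-reflexive (sym (x∈ i))
      ; ≤hi = λ x (x∈ , _) → ≤-reflexive (trans (x∈ i) (sym (+-identityʳ 0#)))
      }
    where
    0∈face : origin ℝ ∈ minimalFace ℝ (λ x → _≋_ ℝ x (origin ℝ)) w
    0∈face = (λ _ → refl) , λ y y∈ → ≤-reflexive (functional-cong ℝ w (λ i → sym (y∈ i)))
  minkowskiSum-Ranges w b (J ∷ Js) ((J≢∅ , b≥0) ∷ ps) =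
    (_ , proj₂ face (_ , _ , scaledBasis∈face w J≢∅ b≥0 (proj₂ (minimizer (Vec.lookup w) J≢∅)) ,
      proj₂ (proj₁ ih) , λ _ → refl)) ,
    λ i → let (lo , r) = face-Range w J≢∅ b≥0 i ; (lo′ , r′) = proj₂ ih i in
      lo + lo′ , Range-≐ ((λ {x} → proj₂ face {x}) , (λ {x} → proj₁ face {x}))
        (Range-≈ refl (interchange lo _ lo′ _) (Range-⊕ r r′))
    where
    ih = minkowskiSum-Ranges w b Js ps
    face = minimalFace-⊕ (dilate ℝ (b J) (simplex ℝ J))
      (minkowskiSum ℝ (map (λ J → dilate ℝ (b J) (simplex ℝ J)) Js)) w

  -- Since A = B + C makes every coordinate range of a face of A the sum of
  -- those of B and C, the face of C is a point iff A and B have faces of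
  -- equal width in every coordinate direction.
  isPoint⇔ : ∀ {n} (V : List (Point ℝ n)) {A B : Pred (Point ℝ n) 0ℓ} {d e} w →
    _⊕_ ℝ B (conv ℝ V) ≐ A → Ranges (minimalFace ℝ A w) d → Ranges (minimalFace ℝ B w) e →
    IsPoint ℝ (minimalFace ℝ (conv ℝ V) w) ⇔ (∀ i → e i ≈ d i)
  isPoint⇔ {n} V {A} {B} {d} {e} w B⊕C≐A (A-point , A-range) (_ , B-range) = mk⇔ equal-widths is-point
    where
    C = conv ℝ V

    A⊆ : ∀ {x} → x ∈ minimalFace ℝ A w → x ∈ _⊕_ ℝ (minimalFace ℝ B w) (minimalFace ℝ C w)
    A⊆ x∈ = proj₁ (minimalFace-⊕ B C w) (proj₂ (minimalFace-≐ w B⊕C≐A) x∈)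

    ⊆A : ∀ {x} → x ∈ _⊕_ ℝ (minimalFace ℝ B w) (minimalFace ℝ C w) → x ∈ minimalFace ℝ A w
    ⊆A x∈ = proj₁ (minimalFace-≐ w B⊕C≐A) (proj₂ (minimalFace-⊕ B C w) x∈)

    equal-widths : IsPoint ℝ (minimalFace ℝ C w) → ∀ i → e i ≈ d i
    equal-widths (p , face≐p) i = sym (+-cancelˡ lA (d i) (e i) (begin
        lA + d i              ≈⟨ proj₂ same ⟩
        lB + e i + p i        ≈⟨ +-assoc lB (e i) (p i) ⟩
        lB + (e i + p i)      ≈⟨ +-congˡ (+-comm (e i) (p i)) ⟩
        lB + (p i + e i)      ≈⟨ +-assoc lB (p i) (e i) ⟨
        lB + p i + e i        ≈⟨ +-congʳ (proj₁ same) ⟨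
        lA + e i              ∎))
      where
      lA = proj₁ (A-range i)
      lB = proj₁ (B-range i)
      same = Range-unique (proj₂ (A-range i))
        (Range-≐ ((λ {x} → ⊆A {x}) , (λ {x} → A⊆ {x}))
          (Range-⊕ (proj₂ (B-range i)) (Range-point face≐p i)))

    is-point : (∀ i → e i ≈ d i) → IsPoint ℝ (minimalFace ℝ C w)
    is-point e≈d = p , (λ {x} x∈ i → trans (coordinate x∈ i) (sym (coordinate p∈ i))) , λ {x} x≋p →
        conv-≋ V x≋p (proj₁ p∈) ,
        λ y y∈ → ≤-resp (functional-cong ℝ w (λ i → sym (x≋p i))) refl (proj₂ p∈ y y∈)
      where
      -- The face of C is non-empty because a point of the face of A splits into face points of B
      -- and C.
      decomposed = A⊆ (proj₂ A-point)
      p = proj₁ (proj₂ decomposed)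
      p∈ : p ∈ minimalFace ℝ C w
      p∈ = proj₁ (proj₂ (proj₂ (proj₂ decomposed)))
      module _ {x} (x∈ : x ∈ minimalFace ℝ C w) (i : Fin n) where
        lA = proj₁ (A-range i)
        lB = proj₁ (B-range i)
        rA = proj₂ (A-range i)
        rB = proj₂ (B-range i)
        -- Adding x to face points of B with smallest and with largest i-th coordinate lands in the
        -- face of A. As the widths agree, the two resulting bounds pin x i to lA - lB, whatever x
        -- is.
        lower : lA ≤ lB + x i
        lower = let (y , y∈ , y≈) = Range.attains-lo rB in
          ≤-resp refl (+-congʳ y≈) (Range.lo≤ rA _ (⊆A (y , x , y∈ , x∈ , λ _ → refl)))
        upper : lB + x i ≤ lA
        upper = let (y , y∈ , y≈) = Range.attains-hi rB in
          +-cancelʳ-≤ (d i) (≤-resp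
            (begin
              y i + x i          ≈⟨ +-congʳ y≈ ⟩
              lB + e i + x i     ≈⟨ +-assoc lB (e i) (x i) ⟩
              lB + (e i + x i)   ≈⟨ +-congˡ (trans (+-comm (e i) (x i)) (+-congˡ (e≈d i))) ⟩
              lB + (x i + d i)   ≈⟨ +-assoc lB (x i) (d i) ⟨
              lB + x i + d i     ∎)
            refl (Range.≤hi rA _ (⊆A (y , x , y∈ , x∈ , λ _ → refl))))
        coordinate : x i ≈ - lB + lA
        coordinate = begin
          x i                 ≈⟨ +-identityˡ (x i) ⟨
          0# + x i            ≈⟨ +-congʳ (-‿inverseˡ lB) ⟨
          - lB + lB + x i     ≈⟨ +-assoc (- lB) lB (x i) ⟩
          - lB + (lB + x i)   ≈⟨ +-congˡ (antisym upper lower) ⟩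
          - lB + lA           ∎

  -- Genericity in terms of ties

  positiveSets : ∀ {n} → (Subset n → Carrier) → List (Subset n)
  positiveSets {n} a = filter (λ J → nonempty? J ×-dec (0# <? a J)) (allSubsets n)

  negativeSets : ∀ {n} → (Subset n → Carrier) → List (Subset n)
  negativeSets {n} a = filter (λ J → nonempty? J ×-dec (a J <? 0#)) (allSubsets n)

  -‿nonNegative : ∀ {x} → x ≤ 0# → 0# ≤ - x
  -‿nonNegative {x} p = ≤-resp refl (+-identityˡ (- x)) (≤⇒0≤ ℝ p)

  -- The sum of the coefficients of the tied sets vanishes, written with the negative coefficients
  -- moved to the left.
  generic⇔ : ∀ {n} (q : GeneralizedPermutahedron ℝ n) w →
    let a = proj₁ (GeneralizedPermutahedron.isMinkowskiDifference q) in
    Generic ℝ q w ⇔ (∀ i → totalWidth w (-_ ∘ a) (negativeSets a) i ≈ totalWidth w a (positiveSets a) i)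
  generic⇔ {n} q w = isPoint⇔ vertices w is-difference
    (minkowskiSum-Ranges w a (positiveSets a)
      (All.map (map₂ proj₁) (All.all-filter (λ J → nonempty? J ×-dec (0# <? a J)) (allSubsets n))))
    (minkowskiSum-Ranges w (-_ ∘ a) (negativeSets a)
      (All.map (map₂ (-‿nonNegative ∘ proj₁))
        (All.all-filter (λ J → nonempty? J ×-dec (a J <? 0#)) (allSubsets n))))
    where
    open GeneralizedPermutahedron q
    a = proj₁ isMinkowskiDifference
    is-difference = proj₂ isMinkowskiDifference

  width-cong : ∀ {n} (w w′ : Vec ℕ n) →
    (∀ {J i} → Tied (Vec.lookup w) J i ⇔ Tied (Vec.lookup w′) J i) → ∀ J i → width w J i ≈ width w′ J i
  width-cong w w′ tied⇔ J i with Tied? (Vec.lookup w) J i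
  ... | yes tied = trans (width-Tied {w = w} tied) (sym (width-Tied {w = w′} (to tied⇔ tied)))
  ... | no ¬tied = trans (width-¬Tied {w = w} ¬tied) (sym (width-¬Tied {w = w′} (¬tied ∘ from tied⇔)))

  totalWidth-cong : ∀ {n} (w w′ : Vec ℕ n) →
    (∀ {J i} → Tied (Vec.lookup w) J i ⇔ Tied (Vec.lookup w′) J i) →
    ∀ b Js i → totalWidth w b Js i ≈ totalWidth w′ b Js i
  totalWidth-cong w w′ tied⇔ b []       i = refl
  totalWidth-cong w w′ tied⇔ b (J ∷ Js) i =
    +-cong (*-congˡ (width-cong w w′ tied⇔ J i)) (totalWidth-cong w w′ tied⇔ b Js i)

  -- The criterion `generic⇔` sees a word only through its widths, that is, through its ties.
  generic-resp : ∀ {n} (q : GeneralizedPermutahedron ℝ n) (w w′ : Vec ℕ n) →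
    (∀ {J i} → Tied (Vec.lookup w) J i ⇔ Tied (Vec.lookup w′) J i) → Generic ℝ q w → Generic ℝ q w′
  generic-resp q w w′ tied⇔ generic = from (generic⇔ q w′) λ i →
    trans (sym (totalWidth-cong w w′ tied⇔ (-_ ∘ a) (negativeSets a) i))
      (trans (to (generic⇔ q w) generic i) (totalWidth-cong w w′ tied⇔ a (positiveSets a) i))
    where
    a = proj₁ (GeneralizedPermutahedron.isMinkowskiDifference q)

  -- Sums of undilated simplices

  ⊕-mono : ∀ {n} {Q Q′ R R′ : Pred (Point ℝ n) 0ℓ} →
    (∀ {x} → x ∈ Q → x ∈ Q′) → (∀ {x} → x ∈ R → x ∈ R′) → ∀ {x} → x ∈ _⊕_ ℝ Q R → x ∈ _⊕_ ℝ Q′ R′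
  ⊕-mono Q⊆ R⊆ (y , z , y∈ , z∈ , e) = y , z , Q⊆ y∈ , R⊆ z∈ , e

  dilate-conv : ∀ {n} {b} (V : List (Point ℝ n)) → b ≈ 1# → dilate ℝ b (conv ℝ V) ≐ conv ℝ V
  dilate-conv V b≈1 =
    (λ (y , y∈ , e) → conv-≋ V (λ i → trans (e i) (trans (*-congʳ b≈1) (*-identityˡ _))) y∈) ,
    (λ {x} x∈ → x , x∈ , λ i → sym (trans (*-congʳ b≈1) (*-identityˡ _)))

  simplexVertices : ∀ {n} → Subset n → List (Point ℝ n)
  simplexVertices {n} J = map (basis ℝ) (filter (_∈? J) (allFin n))

  sumVertices : ∀ {n} → List (Subset n) → List (Point ℝ n)
  sumVertices = foldr (λ J V → simplexVertices J ⊞ˡ V) (origin ℝ ∷ [])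

  minkowskiSum-conv : ∀ {n} (b : Subset n → Carrier) {Js} → All (λ J → b J ≈ 1#) Js →
    minkowskiSum ℝ (map (λ J → dilate ℝ (b J) (simplex ℝ J)) Js) ≐ conv ℝ (sumVertices Js)
  minkowskiSum-conv b [] = (λ {x} → proj₂ (conv-singleton (origin ℝ)) {x}) , (λ {x} → proj₁ (conv-singleton (origin ℝ)) {x})
  minkowskiSum-conv b {J ∷ Js} (b≈1 ∷ bs) =
    (λ {x} x∈ → proj₁ sum≐ (⊕-mono (λ {y} → proj₁ simplex≐ {y}) (λ {y} → proj₁ ih {y}) x∈)) ,
    (λ {x} x∈ → ⊕-mono (λ {y} → proj₂ simplex≐ {y}) (λ {y} → proj₂ ih {y}) (proj₂ sum≐ x∈))
    where
    sum≐ = conv-⊕ (simplexVertices J) (sumVertices Js)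
    simplex≐ = dilate-conv (simplexVertices J) b≈1
    ih = minkowskiSum-conv b bs

  totalWidth-zero⁺ : ∀ {n} (w : Vec ℕ n) b {Js i} → All (λ J → ¬ Tied (Vec.lookup w) J i) Js →
    totalWidth w b Js i ≈ 0#
  totalWidth-zero⁺ w b []           = refl
  totalWidth-zero⁺ w b (¬tied ∷ ps) = trans
    (+-cong (trans (*-congˡ (width-¬Tied {w = w} ¬tied)) (zeroʳ _)) (totalWidth-zero⁺ w b ps))
    (+-identityˡ 0#)

  width-nonNegative : ∀ {n} (w : Vec ℕ n) J i → 0# ≤ width w J i
  width-nonNegative w J i with does (Tied? (Vec.lookup w) J i)
  ... | true  = 0≤1 ℝ
  ... | false = ≤-refl

  totalWidth-nonNegative : ∀ {n} (w : Vec ℕ n) b {Js} → All (λ J → b J ≈ 1#) Js → ∀ i → 0# ≤ totalWidth w b Js i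
  totalWidth-nonNegative w b []                  i = ≤-refl
  totalWidth-nonNegative w b (_∷_ {J} b≈1 bs) i = ≤-resp (+-identityˡ 0#) refl
    (+-mono-≤ ℝ (≤-resp refl (sym (trans (*-congʳ b≈1) (*-identityˡ _))) (width-nonNegative w J i))
      (totalWidth-nonNegative w b bs i))

  -- With all coefficients equal to 1 the summands are non-negative and cannot cancel, so a single
  -- tie makes the total positive.
  totalWidth-zero⁻ : ∀ {n} (w : Vec ℕ n) b {Js i} → All (λ J → b J ≈ 1#) Js →
    totalWidth w b Js i ≈ 0# → All (λ J → ¬ Tied (Vec.lookup w) J i) Js
  totalWidth-zero⁻ w b         []                  _ = []
  totalWidth-zero⁻ w b {i = i} (_∷_ {J} {Js} b≈1 bs) e =
    (λ tied → 0≉1 ℝ (antisym (0≤1 ℝ) (≤-resp (width-Tied {w = w} tied) e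
      (≤-resp (+-identityʳ _) (+-congʳ (sym b*width))
        (+-mono-≤ ℝ ≤-refl rest≥0))))) ∷
    totalWidth-zero⁻ w b bs (antisym
      (≤-resp (+-identityˡ _) (trans (+-congʳ (sym b*width)) e)
        (+-mono-≤ ℝ (width-nonNegative w J i) ≤-refl))
      rest≥0)
    where
    rest≥0 = totalWidth-nonNegative w b bs i
    b*width : b J * width w J i ≈ width w J i
    b*width = trans (*-congʳ b≈1) (*-identityˡ _)

  module _ {n} (π : List (Subset n)) where

    indicator : Subset n → Carrier
    indicator J = if does (∣ J ↾ π ∣ ℕ.≟ 1) then 1# else 0#

    indicator-nonNegative : ∀ J → 0# ≤ indicator J
    indicator-nonNegative J with does (∣ J ↾ π ∣ ℕ.≟ 1)
    ... | true  = 0≤1 ℝ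
    ... | false = ≤-refl

    indicator-≡1 : ∀ {J} → ∣ J ↾ π ∣ ≡ 1 → indicator J ≈ 1#
    indicator-≡1 {J} e = reflexive (≡.cong (if_then 1# else 0#) (dec-true (∣ J ↾ π ∣ ℕ.≟ 1) e))

    indicator-≢1 : ∀ {J} → ∣ J ↾ π ∣ ≢ 1 → indicator J ≈ 0#
    indicator-≢1 {J} e = reflexive (≡.cong (if_then 1# else 0#) (dec-false (∣ J ↾ π ∣ ℕ.≟ 1) e))

    indicator-positive⁻ : ∀ {J} → 0# < indicator J → ∣ J ↾ π ∣ ≡ 1
    indicator-positive⁻ {J} (_ , 0≉a) =
      decidable-stable (∣ J ↾ π ∣ ℕ.≟ 1) λ ≢1 → 0≉a (sym (indicator-≢1 {J} ≢1))

    indicator-positive⁺ : ∀ {J} → ∣ J ↾ π ∣ ≡ 1 → 0# < indicator J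
    indicator-positive⁺ {J} e =
      indicator-nonNegative J , λ 0≈a → 0≉1 ℝ (trans 0≈a (indicator-≡1 {J} e))

    negativeSets-indicator : negativeSets indicator ≡ []
    negativeSets-indicator = List.filter-none (λ J → nonempty? J ×-dec (indicator J <? 0#))
      (All.tabulate {xs = allSubsets n} λ {J} _ (_ , a≤0 , a≉0) → a≉0 (antisym a≤0 (indicator-nonNegative J)))

    positive-indicator : All (λ J → indicator J ≈ 1#) (positiveSets indicator)
    positive-indicator = All.map (λ {J} → indicator-≡1 {J} ∘ indicator-positive⁻ {J} ∘ proj₂)
      (All.all-filter (λ J → nonempty? J ×-dec (0# <? indicator J)) (allSubsets n))

    -- The polytope q_π, which is the hypergraphic polytope of the sets J whose J_π is a singleton.
    -- The listed points are all sums of one basis vector per set; they need not be extreme.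
    hypergraphic : GeneralizedPermutahedron ℝ n
    hypergraphic = record
      { vertices = V
      -- No coefficient is negative, so the subtracted part is the empty sum {0} and only the
      -- positive part has to be matched.
      ; isMinkowskiDifference = indicator , ≡.subst
          (λ Js → _⊕_ ℝ (minkowskiSum ℝ (map (λ J → dilate ℝ (- indicator J) (simplex ℝ J)) Js)) (conv ℝ V)
            ≐ positivePart ℝ indicator)
          (≡.sym negativeSets-indicator)
          ( (λ {x} (y , z , y≋0 , z∈ , e) → proj₂ positive≐
              (conv-≋ V (λ i → trans (e i) (trans (+-congʳ (y≋0 i)) (+-identityˡ _))) z∈))
          , (λ {x} x∈ → origin ℝ , x , (λ _ → refl) , proj₁ positive≐ x∈ , λ i → sym (+-identityˡ _)))
      }
      where
      V = sumVertices (positiveSets indicator)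
      positive≐ = minkowskiSum-conv indicator positive-indicator

    generic-hypergraphic⇔ : ∀ w → Generic ℝ hypergraphic w ⇔
      (∀ J → Nonempty J → ∣ J ↾ π ∣ ≡ 1 → Untied (Vec.lookup w) J)
    generic-hypergraphic⇔ w = mk⇔
      (λ generic J J≢∅ e i → All.lookup
        (totalWidth-zero⁻ w indicator positive-indicator (trans (sym (to (generic⇔ hypergraphic w) generic i)) (negative≈0 i)))
        (List.∈-filter⁺ (λ J → nonempty? J ×-dec (0# <? indicator J)) (allSubsets-complete J)
          (J≢∅ , indicator-positive⁺ {J} e)))
      (λ untied → from (generic⇔ hypergraphic w) λ i → trans (negative≈0 i)
        (sym (totalWidth-zero⁺ w indicator (All.map
          (λ {J} (J≢∅ , 0<a) → untied J J≢∅ (indicator-positive⁻ {J} 0<a) i)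
          (All.all-filter (λ J → nonempty? J ×-dec (0# <? indicator J)) (allSubsets n))))))
      where
      negative≈0 : ∀ i → totalWidth w (-_ ∘ indicator) (negativeSets indicator) i ≈ 0#
      negative≈0 i = ≡.subst (λ Js → totalWidth w (-_ ∘ indicator) Js i ≈ 0#)
        (≡.sym negativeSets-indicator) refl

-- Spans of series

represents-∼ : ∀ {n} {π τ : List (Subset n)} {f} → Represents π f → Represents τ f → π ∼ τ
represents-∼ {π = π} {τ} r s A A≢∅ = mk⇔
  (from (∣↾∣≡1⇔Untied {π = τ} s A≢∅) ∘ to (∣↾∣≡1⇔Untied {π = π} r A≢∅))
  (from (∣↾∣≡1⇔Untied {π = π} r A≢∅) ∘ to (∣↾∣≡1⇔Untied {π = τ} s A≢∅))

-- Both set compositions represent the letters of the same word, so they select the same minimizers.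
rankWord-∼ : ∀ {n} {π : List (Subset n)} → IsSetComposition π → compositionOf (rankWord π) ∼ π
rankWord-∼ {π = π} π-comp =
  represents-∼ {π = compositionOf (rankWord π)} {π} (compositionOf-represents (rankWord π)) (rankWord-represents π-comp)

∼-decSetoid : ℕ → DecSetoid 0ℓ 0ℓ
∼-decSetoid n = record
  { Carrier = List (Subset n)
  ; _≈_ = _∼_
  ; isDecEquivalence = record
    { isEquivalence = record
      { refl  = λ {π} → ∼-refl {π = π}
      ; sym   = λ {π τ} → ∼-sym {π = π} {τ}
      ; trans = λ {π τ ρ} → ∼-trans {π = π} {τ} {ρ}
      }
    ; _≟_ = _∼?_
    }
  }

representatives : ∀ n → List (List (Subset n))
representatives n = deduplicate _∼?_ (setCompositions n)

representatives-sound : ∀ {n} {π : List (Subset n)} → π List.∈ representatives n → IsSetComposition π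
representatives-sound {n} p = setCompositions-sound (List.∈-deduplicate⁻ _∼?_ (setCompositions n) p)

representatives-distinct : ∀ n → AllPairs (λ π τ → ¬ π ∼ τ) (representatives n)
representatives-distinct n = deduplicate-! (∼-decSetoid n) (setCompositions n)

representatives-complete : ∀ {n} {π : List (Subset n)} → IsSetComposition π →
  Any (π ∼_) (representatives n)
representatives-complete {n} {π} π-comp = Any.deduplicate⁺ _∼?_
  (λ {ρ} {τ} τ∼ρ π∼ρ → ∼-trans {π = π} {ρ} {τ} π∼ρ (∼-sym {π = τ} {ρ} τ∼ρ))
  (List.lose (setCompositions-complete π-comp) (∼-refl {π = π}))

module _ {c ℓ₁ ℓ₂ : Level} (K : HeytingField c ℓ₁ ℓ₂) where

  open HeytingField K
  open CommutativeRing (HeytingCommutativeRing.commutativeRing heytingCommutativeRing) using (ring)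
  open RingProperties ring using (-1*x≈-x)

  private
    variable
      i j p : Level
      I : Set i
      J : Set j
      X : Set
      g : I → Series K
      h : J → Series K
      F G : Series K
      m : ℕ

  Span-resp : _≈ˢ_ K F G → Span K g G → Span K g F
  Span-resp F≈G (as , e) = as , λ n w → trans (F≈G n w) (e n w)

  Span-generator : ∀ {I : Set i} (g : I → Series K) x → Span K g (g x)
  Span-generator g x = (1# , x) ∷ [] , λ n w → sym (trans (+-identityʳ _) (*-identityˡ _))

  Span-zero : Span K g (λ _ _ → 0#)
  Span-zero = [] , λ _ _ → refl

  Span-+ : Span K g F → Span K g G → Span K g (λ n w → F n w + G n w)
  Span-+ {g = g} {F} {G} (as , e) (bs , e′) = as ++ bs , λ n w → trans (+-cong (e n w) (e′ n w)) (append as n w)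
    where
    append : ∀ as n w → linearCombination K g as n w + linearCombination K g bs n w ≈ linearCombination K g (as ++ bs) n w
    append []             n w = +-identityˡ _
    append ((a , x) ∷ as) n w = trans (+-assoc _ _ _) (+-congˡ (append as n w))

  Span-* : ∀ a → Span K g F → Span K g (λ n w → a * F n w)
  Span-* {g = g} a (as , e) = map (λ (b , x) → a * b , x) as , λ n w → trans (*-congˡ (e n w)) (scale as n w)
    where
    scale : ∀ as n w → a * linearCombination K g as n w ≈ linearCombination K g (map (λ (b , x) → a * b , x) as) n w
    scale []             n w = zeroʳ a
    scale ((b , x) ∷ as) n w = trans (distribˡ a _ _) (+-cong (sym (*-assoc a b _)) (scale as n w))

  -- `SC` and `Image-Υ` are both spans by definition, so each inclusion reduces to generators.
  Span-⊆ : (∀ x → Span K h (g x)) → Span K g F → Span K h F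
  Span-⊆ {h = h} {g = g} g∈ (as , e) = Span-resp e (combination as)
    where
    combination : ∀ as → Span K h (linearCombination K g as)
    combination []             = Span-zero
    combination ((a , x) ∷ as) = Span-+ (Span-* a (g∈ x)) (combination as)

  -- Sums of monomials over classes of words

  sumSeries : (X → Series K) → List X → Series K
  sumSeries g = foldr (λ x F n w → g x n w + F n w) (λ _ _ → 0#)

  Span-sumSeries : {g : X → Series K} {L : List X} → All (λ x → Span K h (g x)) L → Span K h (sumSeries g L)
  Span-sumSeries []       = Span-zero
  Span-sumSeries (p ∷ ps) = Span-+ p (Span-sumSeries ps)

  Homogeneous : ℕ → Series K → Set ℓ₁
  Homogeneous m F = ∀ n w → m ≢ n → F n w ≈ 0#

  homogeneous-ext : Homogeneous m F → Homogeneous m G → (∀ w → F m w ≈ G m w) → _≈ˢ_ K F G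
  homogeneous-ext {m = m} F-hom G-hom e n w with m ℕ.≟ n
  ... | yes ≡.refl = e w
  ... | no  m≢n    = trans (F-hom n w m≢n) (sym (G-hom n w m≢n))

  monomialSum-homogeneous : {P : Pred (Vec ℕ m) p} (P? : Decidable P) → Homogeneous m (monomialSum K P?)
  monomialSum-homogeneous {m = m} P? n w m≢n with m ℕ.≟ n
  ... | yes m≡n = contradiction m≡n m≢n
  ... | no  _   = refl

  monomialSum-yes : {P : Pred (Vec ℕ m) p} (P? : Decidable P) → ∀ {w} → P w → monomialSum K P? m w ≈ 1#
  monomialSum-yes {m = m} P? {w} pw with m ℕ.≟ m
  ... | yes ≡.refl = reflexive (≡.cong (if_then 1# else 0#) (dec-true (P? w) pw))
  ... | no  m≢m    = contradiction ≡.refl m≢m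

  monomialSum-no : {P : Pred (Vec ℕ m) p} (P? : Decidable P) → ∀ {w} → ¬ P w → monomialSum K P? m w ≈ 0#
  monomialSum-no {m = m} P? {w} ¬pw with m ℕ.≟ m
  ... | yes ≡.refl = reflexive (≡.cong (if_then 1# else 0#) (dec-false (P? w) ¬pw))
  ... | no  _      = refl

  sumSeries-homogeneous : {g : X → Series K} → (∀ x → Homogeneous m (g x)) → ∀ L → Homogeneous m (sumSeries g L)
  sumSeries-homogeneous g-hom []      n w m≢n = refl
  sumSeries-homogeneous g-hom (x ∷ L) n w m≢n =
    trans (+-cong (g-hom x n w m≢n) (sumSeries-homogeneous g-hom L n w m≢n)) (+-identityˡ 0#)

  module _ {P : X → Pred (Vec ℕ m) 0ℓ} (P? : ∀ x → Decidable (P x)) {w : Vec ℕ m} where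

    private
      total : List X → Carrier
      total L = sumSeries (λ x → monomialSum K (P? x)) L m w

    sumSeries-none : ∀ {L} → All (λ x → ¬ P x w) L → total L ≈ 0#
    sumSeries-none []         = refl
    sumSeries-none (¬px ∷ ps) = trans (+-cong (monomialSum-no (P? _) ¬px) (sumSeries-none ps)) (+-identityˡ 0#)

    sumSeries-one : ∀ {L} → AllPairs (λ x y → ¬ (P x w × P y w)) L → Any (λ x → P x w) L → total L ≈ 1#
    sumSeries-one (dis ∷ _) (here px) =
      trans (+-cong (monomialSum-yes (P? _) px) (sumSeries-none (All.map (λ ¬both py → ¬both (px , py)) dis)))
        (+-identityʳ 1#)
    sumSeries-one (dis ∷ diss) (there any) =
      trans (+-cong (monomialSum-no (P? _) λ px → All.lookupWith (λ ¬both py → ¬both (px , py)) dis any)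
          (sumSeries-one diss any))
        (+-identityˡ 1#)

  -- The coefficient of w on the right counts the list entries to which w belongs. By disjointness
  -- this is 1 or 0, so no multiplicities arise.
  monomialSum-partition : {P : X → Pred (Vec ℕ m) 0ℓ} (P? : ∀ x → Decidable (P x))
    {Q : Pred (Vec ℕ m) p} (Q? : Decidable Q) (L : List X) →
    (∀ w → AllPairs (λ x y → ¬ (P x w × P y w)) L) → (∀ w → Q w ⇔ Any (λ x → P x w) L) →
    _≈ˢ_ K (monomialSum K Q?) (sumSeries (λ x → monomialSum K (P? x)) L)
  monomialSum-partition P? Q? L disjoint Q⇔ = homogeneous-ext (monomialSum-homogeneous Q?)
    (sumSeries-homogeneous (λ x → monomialSum-homogeneous (P? x)) L) coefficient
    where
    coefficient : ∀ w → monomialSum K Q? _ w ≈ sumSeries (λ x → monomialSum K (P? x)) L _ w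
    coefficient w with Q? w
    ... | yes q = trans (monomialSum-yes Q? q) (sym (sumSeries-one P? (disjoint w) (to (Q⇔ w) q)))
    ... | no ¬q = trans (monomialSum-no Q? ¬q)
          (sym (sumSeries-none P? (All.¬Any⇒All¬ L (¬q ∘ from (Q⇔ w)))))

  N≈monomialSum : ∀ {n} (π : List (Subset n)) →
    _≈ˢ_ K (monomialSum K (λ w → compositionOf w ∼? π)) (N K π)
  N≈monomialSum {n} π = monomialSum-partition (λ τ w → compositionOf w ≟ᵇ τ) (λ w → compositionOf w ∼? π)
    (filter (_∼? π) (setCompositions n))
    (λ w → AllPairs.map (λ τ≢ρ (e , e′) → τ≢ρ (≡.trans (≡.sym e) e′))
      (AllPairs.filter⁺ (_∼? π) (setCompositions-unique n)))
    (λ w → mk⇔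
      (List.∈-filter⁺ (_∼? π) (setCompositions-complete (compositionOf-isSetComposition w)))
      (proj₂ ∘ List.∈-filter⁻ (_∼? π) {xs = setCompositions n}))

  -- An invariant set of words is a finite disjoint union of `∼`-classes, as there are only finitely
  -- many set compositions. Whether a class belongs to it is tested on the word of its
  -- representative. Leaving h open serves both inclusions.
  Span-classes : {Q : Pred (Vec ℕ m) p} (Q? : Decidable Q) →
    (∀ {u v} → compositionOf u ∼ compositionOf v → Q u → Q v) →
    (∀ {π} → IsSetComposition π → Q (rankWord π) → Span K h (N K π)) →
    Span K h (monomialSum K Q?)
  Span-classes {m = m} {Q = Q} Q? invariant N∈ = Span-resp
    (monomialSum-partition (λ π w → compositionOf w ∼? π) Q? classes disjoint covered)
    (Span-sumSeries (All.tabulate λ {π} π∈ →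
      let (π∈reps , q) = List.∈-filter⁻ (Q? ∘ rankWord) {xs = representatives m} π∈ in
      Span-resp (N≈monomialSum π) (N∈ (representatives-sound π∈reps) q)))
    where
    classes = filter (Q? ∘ rankWord) (representatives m)
    disjoint : ∀ w → AllPairs (λ π τ → ¬ (compositionOf w ∼ π × compositionOf w ∼ τ)) classes
    disjoint w = AllPairs.filter⁺ (Q? ∘ rankWord) (AllPairs.map
      (λ {π} {τ} π≁τ (p , q) → π≁τ (∼-trans {π = π} {compositionOf w} {τ} (∼-sym {π = compositionOf w} {π} p) q))
      (representatives-distinct m))
    rank-∼ : ∀ {w π} → IsSetComposition π → compositionOf w ∼ π → compositionOf w ∼ compositionOf (rankWord π)
    rank-∼ {w} {π} π-comp p = ∼-trans {π = compositionOf w} {π} {compositionOf (rankWord π)} p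
      (∼-sym {π = compositionOf (rankWord π)} {π} (rankWord-∼ π-comp))
    covered : ∀ w → Q w ⇔ Any (compositionOf w ∼_) classes
    covered w = mk⇔
      (λ q → let (π , π∈ , p) = List.find (representatives-complete (compositionOf-isSetComposition w)) in
        List.lose (List.∈-filter⁺ (Q? ∘ rankWord) π∈
          (invariant (rank-∼ {w} (representatives-sound π∈) p) q)) p)
      (λ any → let (π , π∈ , p) = List.find any
                   (π∈reps , q) = List.∈-filter⁻ (Q? ∘ rankWord) {xs = representatives m} π∈ in
        invariant (∼-sym {π = compositionOf w} {compositionOf (rankWord π)}
          (rank-∼ {w} (representatives-sound π∈reps) p)) q)

  SC⊆WQSym : SC K F → WQSym K F
  SC⊆WQSym = Span-⊆ λ (n , π , _) → Span-sumSeries (All.tabulate λ {τ} τ∈ →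
    Span-generator (λ (n , π , _) → M K π)
      (n , τ , setCompositions-sound (proj₁ (List.∈-filter⁻ (_∼? π) {xs = setCompositions n} τ∈))))

  -- The two inclusions

  module _ (ℝ : Reals) where

    Image-Υ⊆SC : Image-Υ K ℝ F → SC K F
    Image-Υ⊆SC = Span-⊆ λ (n , q) → Span-classes (generic? ℝ q)
      (λ {u} {v} u∼v → generic-resp ℝ q u v
        (∼⇒Tied⇔ {π = compositionOf u} {compositionOf v}
          (compositionOf-represents u) (compositionOf-represents v) u∼v))
      (λ {π} π-comp _ → Span-generator (λ (n , π , _) → N K π) (n , π , π-comp))

    generator : ∃ (GeneralizedPermutahedron ℝ) → Series K
    generator (n , q) = monomialSum K (generic? ℝ q)

    generic-hypergraphic⇔⊑ : ∀ {n} (π : List (Subset n)) w →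
      Generic ℝ (hypergraphic ℝ π) w ⇔ π ⊑ compositionOf w
    generic-hypergraphic⇔⊑ π w = mk⇔
      (λ generic J J≢∅ e → from (untied⇔ J≢∅) (to (generic-hypergraphic⇔ ℝ π w) generic J J≢∅ e))
      (λ π⊑ → from (generic-hypergraphic⇔ ℝ π w) λ J J≢∅ e → to (untied⇔ J≢∅) (π⊑ J J≢∅ e))
      where
      untied⇔ : ∀ {J} → Nonempty J → ∣ J ↾ compositionOf w ∣ ≡ 1 ⇔ Untied (Vec.lookup w) J
      untied⇔ = ∣↾∣≡1⇔Untied {π = compositionOf w} (compositionOf-represents w)

    strictlyAbove? : ∀ {n} (π : List (Subset n)) →
      Decidable (λ w → π ⊑ compositionOf w × ¬ compositionOf w ⊑ π)
    strictlyAbove? π w = (π ⊑? compositionOf w) ×-dec ¬? (compositionOf w ⊑? π)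

    -- The generic words of q_π are those w with π ⊑ `compositionOf w`. They split into the class of
    -- π and the words strictly above π; subtracting the latter leaves `N`.
    N≈generator-strictlyAbove : ∀ {n} (π : List (Subset n)) → _≈ˢ_ K (N K π)
      (λ k w → generator (n , hypergraphic ℝ π) k w + (- 1#) * monomialSum K (strictlyAbove? π) k w)
    N≈generator-strictlyAbove {n} π k w = trans (sym (N≈monomialSum π k w)) (homogeneous-ext
        (monomialSum-homogeneous ∼π?)
        (λ k w n≢k → trans (+-cong (monomialSum-homogeneous generic?′ k w n≢k)
            (trans (*-congˡ (monomialSum-homogeneous (strictlyAbove? π) k w n≢k)) (zeroʳ _)))
          (+-identityˡ 0#))
        coefficient k w)
      where
      ∼π? : Decidable (λ w → compositionOf w ∼ π)
      ∼π? w = compositionOf w ∼? π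
      generic?′ = generic? ℝ (hypergraphic ℝ π)
      coefficient : ∀ w → monomialSum K ∼π? n w ≈
        monomialSum K generic?′ n w + (- 1#) * monomialSum K (strictlyAbove? π) n w
      coefficient w with π ⊑? compositionOf w | compositionOf w ⊑? π
      ... | no π⋢ | _ = trans (monomialSum-no ∼π? λ w∼π → π⋢ λ A A≢∅ → from (w∼π A A≢∅))
            (sym (trans (+-cong (monomialSum-no generic?′ (π⋢ ∘ to (generic-hypergraphic⇔⊑ π w)))
                (trans (*-congˡ (monomialSum-no (strictlyAbove? π) (π⋢ ∘ proj₁))) (zeroʳ _)))
              (+-identityˡ 0#)))
      ... | yes π⊑ | yes ⊑π = trans (monomialSum-yes ∼π? (λ A A≢∅ → mk⇔ (⊑π A A≢∅) (π⊑ A A≢∅)))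
            (sym (trans (+-cong (monomialSum-yes generic?′ (from (generic-hypergraphic⇔⊑ π w) π⊑))
                (trans (*-congˡ (monomialSum-no (strictlyAbove? π) λ (_ , ⋢π) → ⋢π ⊑π)) (zeroʳ _)))
              (+-identityʳ 1#)))
      ... | yes π⊑ | no ⋢π = trans (monomialSum-no ∼π? λ w∼π → ⋢π λ A A≢∅ → to (w∼π A A≢∅))
            (sym (trans (+-cong (monomialSum-yes generic?′ (from (generic-hypergraphic⇔⊑ π w) π⊑))
                (trans (*-congˡ (monomialSum-yes (strictlyAbove? π) (π⊑ , ⋢π))) (*-identityʳ _)))
              (-‿inverseʳ 1#)))

    -- The bound k makes the recursion structural. Words strictly above π fall into classes of
    -- smaller corank, and for a maximal class there are none left to subtract.
    N∈Image : ∀ k {n} (π : List (Subset n)) → corank π ℕ.< k → Span K generator (N K π)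
    N∈Image (suc k) {n} π (s≤s corank≤k) = Span-resp (N≈generator-strictlyAbove π)
      (Span-+ (Span-generator generator (n , hypergraphic ℝ π))
        (Span-* (- 1#) (Span-classes (strictlyAbove? π)
          (λ {u} {v} u∼v (π⊑u , u⋢π) →
            (λ A A≢∅ → to (u∼v A A≢∅) ∘ π⊑u A A≢∅) ,
            λ v⊑π → u⋢π λ A A≢∅ → v⊑π A A≢∅ ∘ to (u∼v A A≢∅))
          (λ {τ} τ-comp (π⊑ , ⋢π) → let e = rankWord-∼ τ-comp in
            -- The word of τ is known to lie strictly above π; `rankWord-∼` transfers this to τ
            -- itself.
            N∈Image k τ (ℕ.<-≤-trans (corank-< {π = π} {τ}
              (λ A A≢∅ → to (e A A≢∅) ∘ π⊑ A A≢∅)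
              (λ τ⊑π → ⋢π λ A A≢∅ → τ⊑π A A≢∅ ∘ to (e A A≢∅))) corank≤k)))))

    SC⊆Image-Υ : SC K F → Image-Υ K ℝ F
    SC⊆Image-Υ = Span-⊆ λ (n , π , _) → N∈Image (suc (corank π)) π ℕ.≤-refl

theorem35 : ∀ {c ℓ₁ ℓ₂} (K : HeytingField c ℓ₁ ℓ₂) → CharacteristicZero K → (ℝ : Reals) →
    (∀ g → Υ K ℝ g ∈ WQSym K) × (Image-Υ K ℝ ≐ SC K)
theorem35 K _ ℝ =
  -- The values of `Υ` lie in `WQSym` by way of `SC`, whose generators are finite sums of `M`.
  (λ g → SC⊆WQSym K (Image-Υ⊆SC K ℝ (g , λ _ _ → HeytingField.refl K))) ,
  (Image-Υ⊆SC K ℝ , SC⊆Image-Υ K ℝ)
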